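{- Let $\Psi$ be a finite set of dimension names and let $M$ be a term with no free term variables and with free dimension names contained in $\Psi$. If $M\in\mathsf{bool}\ [\Psi]$ (relative to the cubical type system $\tau^{\mathsf{pre}}_\omega$), then $M\Downarrow\mathsf{true}$ or $M\Downarrow\mathsf{false}$.
   Context: **Syntax.** A dimension $r$ is a constant $0$ or $1$ or a dimension name ($x,y,z,w,\dots$); $\varepsilon$ ranges over $\{0,1\}$ and $\bar\varepsilon$ is the opposite constant. Terms (with term variables $a,b,c,f,n,\dots$; indices $j\in\mathbb N$) are: variables, $(a{:}A)\to B$, $(a{:}A)\times B$, $\mathsf{Path}_{x.A}(M,N)$, $\mathsf{Eq}_A(M,N)$, $\mathsf{void}$, $\mathsf{nat}$, $\mathsf{bool}$, $\mathsf{wbool}$, $\mathbb S^1$, $\mathcal U^{\mathsf{pre}}_j$, $\mathcal U^{\mathsf{Kan}}_j$, $\mathsf V_r(A,B,E)$, $\mathsf{Vin}_r(M,N)$, $\mathsf{Vproj}_r(M,F)$, $\lambda a.M$, $\mathsf{app}(M,N)$, $\langle M,N\rangle$, $\mathsf{fst}(M)$, $\mathsf{snd}(M)$, $\langle x\rangle M$, $M@r$, $\star$, $\mathsf z$, $\mathsf s(M)$, $\mathsf{natrec}(M;N_1,n.a.N_2)$, $\mathsf{true}$, $\mathsf{false}$, $\mathsf{if}_{b.A}(M;N_1,N_2)$, $\mathsf{base}$, $\mathsf{loop}_r$, $\mathbb S^1\text{ - }\mathsf{elim}_{c.A}(M;N_1,x.N_2)$, $\mathsf{coe}_{x.A}^{r\rightsquigarrow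 r'}(M)$, $\mathsf{hcom}_A^{r\rightsquigarrow r'}(M;T)$, $\mathsf{com}_{y.A}^{r\rightsquigarrow r'}(M;T)$, $\mathsf{fcom}^{r\rightsquigarrow r'}(M;T)$, $\mathsf{ghcom}_A^{r\rightsquigarrow r'}(M;T)$, $\mathsf{gcom}_{y.A}^{r\rightsquigarrow r'}(M;T)$, $\mathsf{box}^{r\rightsquigarrow r'}(M;\xi_i\hookrightarrow N_i)$, $\mathsf{cap}^{r\leftarrow r'}(M;T)$. Here $T$ is a finite, possibly empty list of entries $\xi_i\hookrightarrow y.N_i$, where $\xi_i$ abbreviates the equation $r_i=r_i'$ of dimensions; a displayed entry with index $i$ (or $j$) stands for the whole list, and an entry mentioning a free $\varepsilon$ for the two entries $\varepsilon=0,1$. A dot binds the preceding dimension names or variables ($x.$, $y.$, $a.$, ...), $\langle x\rangle M$ binds $x$ in $M$, and $a$ is bound in $B$ in $(a{:}A)\to B$, $(a{:}A)\times B$. $A\to B$ and $A\times B$ are the nondependent cases. $\mathsf{FD}(M)$ is the set of free dimension names; $M\langle r/x\rangle$ is dimension substitution, $M[N/a]$ term substitution. $M\ \mathsf{tm}\,[\Psi]$ means $M$ has no free term variables and $\mathsf{FD}(M)\subseteq\Psi$; $x\#\xi$ means $x$ does not occur in $\xi$. A dimension substitution $\psi:\Psi'\to\Psi$ assigns to each name in $\Psi$ either $0$, $1$ or a name in $\Psi'$; $M\psi$ is its action, $\psi_1\psi_2$ is first $\psi_1$ then $\psi_2$. **Operational semantics** (on terms with no free term variables; $M\ \mathsf{val}$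 and $M\longmapsto M'$ are the least relations given by the following; $r\ne r'$ is syntactic). $M\Downarrow V$ means $M\longmapsto^*V$ and $V\ \mathsf{val}$. *Values:* $(a{:}A)\to B$, $(a{:}A)\times B$, $\mathsf{Path}_{x.A}(M,N)$, $\mathsf{Eq}_A(M,N)$, $\mathsf{void},\mathsf{nat},\mathsf{bool},\mathsf{wbool},\mathbb S^1,\mathcal U^{\mathsf{pre}}_j,\mathcal U^{\mathsf{Kan}}_j$, $\mathsf V_x(A,B,E)$ ($x$ a name), $\lambda a.M$, $\langle M,N\rangle$, $\langle x\rangle M$, $\star$, $\mathsf z$, $\mathsf s(M)$, $\mathsf{true},\mathsf{false},\mathsf{base}$, $\mathsf{loop}_x$, $\mathsf{Vin}_x(M,N)$ ($x$ a name), and $\mathsf{fcom}^{r\rightsquigarrow r'}(M;r_i=r_i'\hookrightarrow y.N_i)$, $\mathsf{box}^{r\rightsquigarrow r'}(M;r_i=r_i'\hookrightarrow N_i)$ when $r\ne r'$ and $r_i\neq r_i'$ for all $i$. *Congruence:* if $A\longmapsto A'$ then $\mathsf{hcom}_A^{r\rightsquigarrow r'}(M;T)\longmapsto\mathsf{hcom}_{A'}^{r\rightsquigarrow r'}(M;T)$ and $\mathsf{coe}_{x.A}^{r\rightsquigarrow r'}(M)\longmapsto\mathsf{coe}_{x.A'}^{r\rightsquigarrow r'}(M)$; if $M\longmapsto M'$ then the principal argument $M$ may be replaced by $M'$ in $\mathsf{app}(M,N)$, $\mathsf{fst}(M)$, $\mathsf{snd}(M)$, $M@r$, $\mathsf{natrec}(M;\ldots)$,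 $\mathsf{if}_{b.A}(M;\ldots)$, $\mathbb S^1\text{ - }\mathsf{elim}_{c.A}(M;\ldots)$, $\mathsf{Vproj}_x(M,F)$ ($x$ a name), and $\mathsf{cap}^{r\leftarrow r'}(M;r_i=r_i'\hookrightarrow y.B_i)$ provided $r\neq r'$ and $r_i\ne r_i'$ for all $i$. *General Kan operations:* - $\mathsf{com}_{y.A}^{r\rightsquigarrow r'}(M;\xi_i\hookrightarrow y.N_i)\longmapsto\mathsf{hcom}_{A\langle r'/y\rangle}^{r\rightsquigarrow r'}(\mathsf{coe}_{y.A}^{r\rightsquigarrow r'}(M);\xi_i\hookrightarrow y.\mathsf{coe}_{y.A}^{y\rightsquigarrow r'}(N_i))$; $\mathsf{gcom}$ steps likewise with $\mathsf{ghcom}$ for $\mathsf{hcom}$. - $\mathsf{fcom}^{r\rightsquigarrow r'}(M;T)\longmapsto M$ if $r=r'$; $\longmapsto N_j\langle r'/y\rangle$ if $r\ne r'$ and $j$ is least with $r_j=r_j'$. - $\mathsf{ghcom}_A^{r\rightsquigarrow r'}(M;\cdot)\longmapsto M$; $\mathsf{ghcom}_A^{r\rightsquigarrow r'}(M;s=s'\hookrightarrow y.N,\xi_i\hookrightarrow y.N_i)\longmapsto\mathsf{hcom}_A^{r\rightsquigarrow r'}(M;s=\varepsilon\hookrightarrow z.T_\varepsilon,\,s=s'\hookrightarrow y.N,\,\xi_i\hookrightarrow y.N_i)$ with $T_\varepsilon=\mathsf{hcom}_A^{r\rightsquigarrow z}(M;s'=\varepsilon\hookrightarrow y.N,\,s'=\bar\varepsilon\hookrightarrow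 y.\mathsf{ghcom}_A^{r\rightsquigarrow y}(M;\xi_i\hookrightarrow y.N_i),\,\xi_i\hookrightarrow y.N_i)$. *Functions:* $\mathsf{app}(\lambda a.M,N)\longmapsto M[N/a]$; $\mathsf{hcom}_{(a:A)\to B}^{r\rightsquigarrow r'}(M;\xi_i\hookrightarrow y.N_i)\longmapsto\lambda a.\mathsf{hcom}_B^{r\rightsquigarrow r'}(\mathsf{app}(M,a);\xi_i\hookrightarrow y.\mathsf{app}(N_i,a))$; $\mathsf{coe}_{x.(a:A)\to B}^{r\rightsquigarrow r'}(M)\longmapsto\lambda a.\mathsf{coe}_{x.B[\mathsf{coe}_{x.A}^{r'\rightsquigarrow x}(a)/a]}^{r\rightsquigarrow r'}(\mathsf{app}(M,\mathsf{coe}_{x.A}^{r'\rightsquigarrow r}(a)))$. *Pairs:* $\mathsf{fst}(\langle M,N\rangle)\longmapsto M$; $\mathsf{snd}(\langle M,N\rangle)\longmapsto N$; $\mathsf{hcom}_{(a:A)\times B}^{r\rightsquigarrow r'}(M;\xi_i\hookrightarrow y.N_i)\longmapsto\langle\mathsf{hcom}_A^{r\rightsquigarrow r'}(\mathsf{fst}(M);\xi_i\hookrightarrow y.\mathsf{fst}(N_i)),\ \mathsf{com}_{z.B[F/a]}^{r\rightsquigarrow r'}(\mathsf{snd}(M);\xi_i\hookrightarrow y.\mathsf{snd}(N_i))\rangle$ with $F=\mathsf{hcom}_A^{r\rightsquigarrow z}(\mathsf{fst}(M);\xi_i\hookrightarrow y.\mathsf{fst}(N_i))$; $\mathsf{coe}_{x.(a:A)\times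 B}^{r\rightsquigarrow r'}(M)\longmapsto\langle\mathsf{coe}_{x.A}^{r\rightsquigarrow r'}(\mathsf{fst}(M)),\mathsf{coe}^{r\rightsquigarrow r'}_{x.B[\mathsf{coe}_{x.A}^{r\rightsquigarrow x}(\mathsf{fst}(M))/a]}(\mathsf{snd}(M))\rangle$. *Paths:* $(\langle x\rangle M)@r\longmapsto M\langle r/x\rangle$; $\mathsf{hcom}_{\mathsf{Path}_{x.A}(P_0,P_1)}^{r\rightsquigarrow r'}(M;\xi_i\hookrightarrow y.N_i)\longmapsto\langle x\rangle\mathsf{hcom}_A^{r\rightsquigarrow r'}(M@x;x=\varepsilon\hookrightarrow\_.P_\varepsilon,\,\xi_i\hookrightarrow y.N_i@x)$; $\mathsf{coe}_{y.\mathsf{Path}_{x.A}(P_0,P_1)}^{r\rightsquigarrow r'}(M)\longmapsto\langle x\rangle\mathsf{com}_{y.A}^{r\rightsquigarrow r'}(M@x;x=\varepsilon\hookrightarrow y.P_\varepsilon)$. *Equality:* $\mathsf{hcom}_{\mathsf{Eq}_A(E_0,E_1)}^{r\rightsquigarrow r'}(M;T)\longmapsto\star$. *Base types:* $\mathsf{natrec}(\mathsf z;Z,n.a.S)\longmapsto Z$; $\mathsf{natrec}(\mathsf s(M);Z,n.a.S)\longmapsto S[M/n][\mathsf{natrec}(M;Z,n.a.S)/a]$; $\mathsf{if}_{b.A}(\mathsf{true};T,F)\longmapsto T$; $\mathsf{if}_{b.A}(\mathsf{false};T,F)\longmapsto F$; $\mathsf{hcom}_{C}^{r\rightsquigarrow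 r'}(M;T)\longmapsto M$ for $C\in\{\mathsf{nat},\mathsf{bool}\}$; $\mathsf{coe}_{x.C}^{r\rightsquigarrow r'}(M)\longmapsto M$ for $C\in\{\mathsf{nat},\mathsf{bool},\mathsf{wbool},\mathbb S^1\}$; $\mathsf{hcom}_C^{r\rightsquigarrow r'}(M;T)\longmapsto\mathsf{fcom}^{r\rightsquigarrow r'}(M;T)$ for $C\in\{\mathsf{wbool},\mathbb S^1\}$; $\mathsf{loop}_\varepsilon\longmapsto\mathsf{base}$; $\mathbb S^1\text{ - }\mathsf{elim}_{c.A}(\mathsf{base};P,x.L)\longmapsto P$; $\mathbb S^1\text{ - }\mathsf{elim}_{c.A}(\mathsf{loop}_w;P,x.L)\longmapsto L\langle w/x\rangle$ ($w$ a name). If $r\ne r'$ and $r_i\neq r_i'$ for all $i$, with $H=\mathsf{fcom}^{r\rightsquigarrow z}(M;\xi_i\hookrightarrow y.N_i)$: $\mathsf{if}_{b.A}(\mathsf{fcom}^{r\rightsquigarrow r'}(M;\xi_i\hookrightarrow y.N_i);T,F)\longmapsto\mathsf{com}_{z.A[H/b]}^{r\rightsquigarrow r'}(\mathsf{if}_{b.A}(M;T,F);\xi_i\hookrightarrow y.\mathsf{if}_{b.A}(N_i;T,F))$, and $\mathbb S^1\text{ - }\mathsf{elim}_{c.A}(\mathsf{fcom}^{r\rightsquigarrow r'}(M;\xi_i\hookrightarrow y.N_i);P,x.L)\longmapsto\mathsf{com}_{z.A[H/c]}^{r\rightsquigarrow r'}(\mathbb S^1\text{ - }\mathsf{elim}_{c.A}(M;P,x.L);\xi_i\hookrightarrow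 y.\mathbb S^1\text{ - }\mathsf{elim}_{c.A}(N_i;P,x.L))$. *V types* ($x,y$ names): $\mathsf V_0(A,B,E)\longmapsto A$; $\mathsf V_1(A,B,E)\longmapsto B$; $\mathsf{Vin}_0(M,N)\longmapsto M$; $\mathsf{Vin}_1(M,N)\longmapsto N$; $\mathsf{Vproj}_0(M,F)\longmapsto\mathsf{app}(F,M)$; $\mathsf{Vproj}_1(M,F)\longmapsto M$; $\mathsf{Vproj}_x(\mathsf{Vin}_x(M,N),F)\longmapsto N$. - $\mathsf{hcom}_{\mathsf V_x(A,B,E)}^{r\rightsquigarrow r'}(M;\xi_i\hookrightarrow y.N_i)\longmapsto\mathsf{Vin}_x(O\langle r'/y\rangle,\mathsf{hcom}_B^{r\rightsquigarrow r'}(\mathsf{Vproj}_x(M,\mathsf{fst}(E));\xi_i\hookrightarrow y.\mathsf{Vproj}_x(N_i,\mathsf{fst}(E)),\,x=0\hookrightarrow y.\mathsf{app}(\mathsf{fst}(E),O),\,x=1\hookrightarrow y.\mathsf{hcom}_B^{r\rightsquigarrow y}(M;\xi_i\hookrightarrow y.N_i)))$ with $O=\mathsf{hcom}_A^{r\rightsquigarrow y}(M;\xi_i\hookrightarrow y.N_i)$. - $\mathsf{coe}_{x.\mathsf V_x(A,B,E)}^{0\rightsquigarrow r'}(M)\longmapsto\mathsf{Vin}_{r'}(M,\mathsf{coe}_{x.B}^{0\rightsquigarrow r'}(\mathsf{app}(\mathsf{fst}(E\langle0/x\rangle),M)))$. - $\mathsf{coe}_{x.\mathsf V_x(A,B,E)}^{1\rightsquigarrow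 r'}(N)\longmapsto\mathsf{Vin}_{r'}(\mathsf{fst}(O),P)$ with $O=\mathsf{fst}(\mathsf{app}(\mathsf{snd}(E\langle r'/x\rangle),\mathsf{coe}_{x.B}^{1\rightsquigarrow r'}(N)))$, $P=\mathsf{hcom}_{B\langle r'/x\rangle}^{1\rightsquigarrow0}(\mathsf{coe}_{x.B}^{1\rightsquigarrow r'}(N);r'=0\hookrightarrow y.\mathsf{snd}(O)@y,\,r'=1\hookrightarrow\_.\mathsf{coe}_{x.B}^{1\rightsquigarrow r'}(N))$. - $\mathsf{coe}_{x.\mathsf V_x(A,B,E)}^{y\rightsquigarrow r'}(M)\longmapsto\mathsf{Vin}_{r'}(\mathsf{fst}(R),\mathsf{hcom}_{B\langle r'/x\rangle}^{1\rightsquigarrow0}(P\langle r'/x\rangle;\,y=\varepsilon\hookrightarrow\_.O_\varepsilon\langle r'/w\rangle,\,y=r'\hookrightarrow\_.\mathsf{Vproj}_{r'}(M,\mathsf{fst}(E\langle r'/x\rangle)),\,r'=0\hookrightarrow z.\mathsf{snd}(R)@z))$ where $O_\varepsilon=\mathsf{Vproj}_w(\mathsf{coe}_{x.\mathsf V_x(A,B,E)}^{\varepsilon\rightsquigarrow w}(M),\mathsf{fst}(E\langle w/x\rangle))$; $P=\mathsf{com}_{x.B}^{y\rightsquigarrow x}(\mathsf{Vproj}_y(M,\mathsf{fst}(E\langle y/x\rangle));y=\varepsilon\hookrightarrow w.O_\varepsilon)$; $Q_\varepsilon[a]=\langle\mathsf{coe}_{y.A\langle0/x\rangle}^{\varepsilon\rightsquigarrow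 y}(a),\langle z\rangle\mathsf{com}_{y.B\langle0/x\rangle}^{\varepsilon\rightsquigarrow y}(P\langle0/x\rangle\langle\varepsilon/y\rangle;z=0\hookrightarrow y.\mathsf{app}(\mathsf{fst}(E\langle0/x\rangle),\mathsf{coe}_{y.A\langle0/x\rangle}^{\varepsilon\rightsquigarrow y}(a)),\,z=1\hookrightarrow y.P\langle0/x\rangle)\rangle$; $R=\mathsf{app}(\mathsf{app}(\mathsf{snd}(\mathsf{app}(\mathsf{snd}(E\langle0/x\rangle),P\langle0/x\rangle)),Q_0[M\langle0/y\rangle]),Q_1[(\mathsf{coe}_{x.\mathsf V_x(A,B,E)}^{1\rightsquigarrow0}(M))\langle1/y\rangle])@y$. - If $x\neq y$: $\mathsf{coe}_{y.\mathsf V_x(A,B,E)}^{r\rightsquigarrow r'}(M)\longmapsto\mathsf{Vin}_x(\mathsf{coe}_{y.A}^{r\rightsquigarrow r'}(M),\mathsf{com}_{y.B}^{r\rightsquigarrow r'}(\mathsf{Vproj}_x(M,\mathsf{fst}(E\langle r/y\rangle));x=0\hookrightarrow y.\mathsf{app}(\mathsf{fst}(E),\mathsf{coe}_{y.A}^{r\rightsquigarrow y}(M)),\,x=1\hookrightarrow y.\mathsf{coe}_{y.B}^{r\rightsquigarrow y}(M)))$. *Universes and composite types:* $\mathsf{hcom}_{\mathcal U^{\mathsf{Kan}}_j}^{r\rightsquigarrow r'}(M;T)\longmapsto\mathsf{fcom}^{r\rightsquigarrow r'}(M;T)$; $\mathsf{coe}_{x.\mathcal U^\kappa_j}^{r\rightsquigarrow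 r'}(M)\longmapsto M$ ($\kappa\in\{\mathsf{pre},\mathsf{Kan}\}$). - $\mathsf{box}^{r\rightsquigarrow r'}(M;\xi_i\hookrightarrow N_i)\longmapsto M$ if $r=r'$, $\longmapsto N_j$ if $r\neq r'$ and $j$ is least with $r_j=r_j'$. $\mathsf{cap}^{r\leftarrow r'}(M;\xi_i\hookrightarrow y.B_i)\longmapsto M$ if $r=r'$, $\longmapsto\mathsf{coe}_{y.B_j}^{r'\rightsquigarrow r}(M)$ if $r\ne r'$ and $j$ is least with $r_j=r_j'$. If $r\neq r'$ and all $r_i\neq r_i'$: $\mathsf{cap}^{r\leftarrow r'}(\mathsf{box}^{r\rightsquigarrow r'}(M;\xi_i\hookrightarrow N_i);\xi_i\hookrightarrow y.B_i)\longmapsto M$. - If $s\neq s'$, all $s_j\ne s_j'$: $\mathsf{hcom}_{\mathsf{fcom}^{s\rightsquigarrow s'}(A;s_j=s_j'\hookrightarrow z.B_j)}^{r\rightsquigarrow r'}(M;\xi_i\hookrightarrow y.N_i)\longmapsto\mathsf{box}^{s\rightsquigarrow s'}(Q;s_j=s_j'\hookrightarrow P_j\langle s'/z\rangle)$ where $P_j=\mathsf{hcom}_{B_j}^{r\rightsquigarrow r'}(\mathsf{coe}_{z.B_j}^{s'\rightsquigarrow z}(M);\xi_i\hookrightarrow y.\mathsf{coe}_{z.B_j}^{s'\rightsquigarrow z}(N_i))$; $F[c]=\mathsf{hcom}_A^{s'\rightsquigarrow z}(\mathsf{cap}^{s\leftarrow s'}(c;s_j=s_j'\hookrightarrow z.B_j);s_j=s_j'\hookrightarrow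 z'.\mathsf{coe}_{z.B_j}^{z'\rightsquigarrow s}(\mathsf{coe}_{z.B_j}^{s'\rightsquigarrow z'}(c)))$; $O=\mathsf{hcom}_A^{r\rightsquigarrow r'}((F[M])\langle s/z\rangle;\xi_i\hookrightarrow y.(F[N_i])\langle s/z\rangle)$; $Q=\mathsf{hcom}_A^{s\rightsquigarrow s'}(O;\xi_i\hookrightarrow z.F[N_i\langle r'/y\rangle],\,s_j=s_j'\hookrightarrow z.\mathsf{coe}_{z.B_j}^{z\rightsquigarrow s}(P_j),\,r=r'\hookrightarrow z.F[M])$. - If $s\neq s'$, all $s_i\neq s_i'$: $\mathsf{coe}_{x.\mathsf{fcom}^{s\rightsquigarrow s'}(A;s_i=s_i'\hookrightarrow z.B_i)}^{r\rightsquigarrow r'}(M)\longmapsto(\mathsf{box}^{s\rightsquigarrow s'}(\mathsf{hcom}_A^{s\rightsquigarrow s'}(P;s_i=s_i'\hookrightarrow z.\mathsf{coe}_{z.B_i}^{z\rightsquigarrow s}(Q_i),\,r=r'\hookrightarrow z.O);s_i=s_i'\hookrightarrow Q_i\langle s'/z\rangle))\langle r'/x\rangle$ where $N_i=\mathsf{coe}_{z.B_i}^{s'\rightsquigarrow z}(\mathsf{coe}_{x.B_i\langle s'/z\rangle}^{r\rightsquigarrow x}(M))$; $O=(\mathsf{hcom}_A^{s'\rightsquigarrow z}(\mathsf{cap}^{s\leftarrow s'}(M;s_i=s_i'\hookrightarrow z.B_i);s_i=s_i'\hookrightarrow z.\mathsf{coe}_{z.B_i}^{z\rightsquigarrow s}(N_i)))\langle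 r/x\rangle$; $P=\mathsf{gcom}_{x.A}^{r\rightsquigarrow r'}(O\langle s\langle r/x\rangle/z\rangle;\ s_i=s_i'\hookrightarrow x.N_i\langle s/z\rangle$ (only those $i$ with $x\#s_i,s_i'$)$,\ s=s'\hookrightarrow x.\mathsf{coe}_{x.A}^{r\rightsquigarrow x}(M)$ (only if $x\#s,s'$)$)$; $Q_k=\mathsf{gcom}_{z.B_k\langle r'/x\rangle}^{s\langle r'/x\rangle\rightsquigarrow z}(P;\ s_i=s_i'\hookrightarrow z.N_i\langle r'/x\rangle$ (only those $i$ with $x\#s_i,s_i'$)$,\ r=r'\hookrightarrow z.N_k\langle r'/x\rangle)$. **Type systems.** A candidate cubical type system is a relation $\tau(\Psi,A_0,B_0,\varphi)$ on values $A_0,B_0$ over $\Psi$ and binary relations $\varphi$ on values over $\Psi$. $R^{\Downarrow}$ denotes the lifting of a relation on values to terms by evaluation. A $\Psi$-relation $\alpha$ is a family $\alpha_\psi$ of binary relations on terms over $\Psi'$, indexed by $\psi:\Psi'\to\Psi$ ("over values" if only values are related); $\alpha$ alone means $\alpha_{\mathrm{id}}$; $(\alpha\psi)_{\psi'}=\alpha_{\psi\psi'}$. A context-indexed relation $R_\Psi$ gives a $\Psi$-relation $R(\Psi)$ by $R(\Psi)_\psi=R_{\Psi'}$. - $\mathsf{PTy}(\tau)(\Psi,A,B,\alpha)$ ($\alpha$ a $\Psi$-relation over values): for all $\psi:\Psi'\to\Psi$, $\tau^\Downarrow(\Psi',A\psi,B\psi,\alpha_\psi)$; and for all $\psi_1:\Psi_1\to\Psi$,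 $\psi_2:\Psi_2\to\Psi_1$: $A\psi_1\Downarrow A_1$, $B\psi_1\Downarrow B_1$ and, for some $\varphi$, $\tau^\Downarrow(\Psi_2,-,-,\varphi)$ relates $(A_1\psi_2,A\psi_1\psi_2)$, $(A\psi_1\psi_2,A_1\psi_2)$, $(B_1\psi_2,B\psi_1\psi_2)$, $(B\psi_1\psi_2,B_1\psi_2)$, $(A_1\psi_2,B_1\psi_2)$. - $\mathsf{Tm}(\alpha)(M,N)$: for all $\psi_1:\Psi_1\to\Psi$, $\psi_2:\Psi_2\to\Psi_1$: $M\psi_1\Downarrow M_1$, $N\psi_1\Downarrow N_1$ and $\alpha^\Downarrow_{\psi_1\psi_2}$ relates $(M_1\psi_2,M\psi_1\psi_2)$, $(M\psi_1\psi_2,M_1\psi_2)$, $(N_1\psi_2,N\psi_1\psi_2)$, $(N\psi_1\psi_2,N_1\psi_2)$, $(M_1\psi_2,N_1\psi_2)$. - $\mathsf{Coh}(\alpha)$: for all $\psi$, $\alpha_\psi(M_0,N_0)$ implies $\mathsf{Tm}(\alpha\psi)(M_0,N_0)$. $\mu$ denotes least fixed points (for inclusion). $\mathbb N=\mu R.\{(\Psi,\mathsf z,\mathsf z)\}\cup\{(\Psi,\mathsf s(M),\mathsf s(M'))\mid\mathsf{Tm}(R(\Psi))(M,M')\}$; $\mathbb B=\mu R.\{(\Psi,\mathsf{true},\mathsf{true}),(\Psi,\mathsf{false},\mathsf{false})\}\cup\mathrm{FKan}(R)$; $\mathbb C=\mu R.\{(\Psi,\mathsf{base},\mathsf{base}),((\Psi,x),\mathsf{loop}_x,\mathsf{loop}_x)\}\cup\mathrm{FKan}(R)$,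 where $\mathrm{FKan}(R)$ consists of all $(\Psi,\mathsf{fcom}^{r\rightsquigarrow r'}(M;r_i=r_i'\hookrightarrow y.N_i),\mathsf{fcom}^{r\rightsquigarrow r'}(M';r_i=r_i'\hookrightarrow y.N_i'))$ with $(\dagger)$: $r\neq r'$, $r_i\ne r_i'$ for all $i$, and some $i,j$ have $r_i=r_j,r_i'=0,r_j'=1$; $\mathsf{Tm}(R(\Psi))(M,M')$; $\mathsf{Tm}(R(\Psi'))(N_i\psi,N_j'\psi)$ for all $i,j$ and $\psi:\Psi'\to(\Psi,y)$ with $r_i\psi=r_i'\psi$, $r_j\psi=r_j'\psi$; and $\mathsf{Tm}(R(\Psi'))(N_i\langle r/y\rangle\psi,M\psi)$ for all $i$ and $\psi:\Psi'\to\Psi$ with $r_i\psi=r_i'\psi$. Abbreviate $\mathsf{isContr}(C):=C\times((c{:}C)\to(c'{:}C)\to\mathsf{Path}_{\_.C}(c,c'))$ and $\mathsf{Equiv}(A,B):=(f{:}A\to B)\times((b{:}B)\to\mathsf{isContr}((a{:}A)\times\mathsf{Path}_{\_.B}(\mathsf{app}(f,a),b)))$. Operators on candidate cubical type systems: - $\mathrm{Fun}(\tau)$ (resp. $\mathrm{Pair}(\tau)$): all $(\Psi,(a{:}A)\to B,(a{:}A')\to B',\varphi)$ (resp. with $\times$) such that there are $\alpha$, $\beta^{\psi,M,M'}$ with $\mathsf{PTy}(\tau)(\Psi,A,A',\alpha)$, $\mathsf{Coh}(\alpha)$, and for all $\psi:\Psi'\to\Psi$ and $\mathsf{Tm}(\alpha\psi)(M,M')$,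 $\mathsf{PTy}(\tau)(\Psi',B\psi[M/a],B'\psi[M'/a],\beta^{\psi,M,M'})$ and $\mathsf{Coh}(\beta^{\psi,M,M'})$; with $\varphi=\{(\lambda a.N,\lambda a.N')\mid\forall\psi,M,M'.\ \mathsf{Tm}(\alpha\psi)(M,M')\Rightarrow\mathsf{Tm}(\beta^{\psi,M,M'})(N\psi[M/a],N'\psi[M'/a])\}$ (resp. $\varphi=\{(\langle M,N\rangle,\langle M',N'\rangle)\mid\mathsf{Tm}(\alpha)(M,M')\wedge\mathsf{Tm}(\beta^{\mathrm{id},M,M'})(N,N')\}$). - $\mathrm{Path}(\tau)$: all $(\Psi,\mathsf{Path}_{x.A}(P_0,P_1),\mathsf{Path}_{x.A'}(P_0',P_1'),\varphi)$ with, for some $\alpha$, $\mathsf{PTy}(\tau)((\Psi,x),A,A',\alpha)$, $\mathsf{Coh}(\alpha)$, $\mathsf{Tm}(\alpha\langle\varepsilon/x\rangle)(P_\varepsilon,P_\varepsilon')$ for $\varepsilon=0,1$, and $\varphi=\{(\langle x\rangle M,\langle x\rangle M')\mid\mathsf{Tm}(\alpha)(M,M')\wedge\forall\varepsilon.\mathsf{Tm}(\alpha\langle\varepsilon/x\rangle)(M\langle\varepsilon/x\rangle,P_\varepsilon)\}$. - $\mathrm{Eq}(\tau)$: all $(\Psi,\mathsf{Eq}_A(M,N),\mathsf{Eq}_{A'}(M',N'),\varphi)$ with, for some $\alpha$, $\mathsf{PTy}(\tau)(\Psi,A,A',\alpha)$, $\mathsf{Coh}(\alpha)$, $\mathsf{Tm}(\alpha)(M,M')$,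 $\mathsf{Tm}(\alpha)(N,N')$, $\varphi=\{(\star,\star)\mid\mathsf{Tm}(\alpha)(M,N)\}$. - $\mathrm V(\tau)$: all $((\Psi,x),\mathsf V_x(A,B,E),\mathsf V_x(A',B',E'),\varphi)$ with, for some $\beta,\alpha^\psi,\eta^\psi$: $\mathsf{PTy}(\tau)((\Psi,x),B,B',\beta)$, $\mathsf{Coh}(\beta)$; for all $\psi:\Psi'\to(\Psi,x)$ with $x\psi=0$, $\mathsf{PTy}(\tau)(\Psi',A\psi,A'\psi,\alpha^\psi)$, $\mathsf{Coh}(\alpha^\psi)$, $\mathsf{PTy}(\tau)(\Psi',\mathsf{Equiv}(A\psi,B\psi),\mathsf{Equiv}(A\psi,B\psi),\eta^\psi)$, $\mathsf{Tm}(\eta^\psi)(E\psi,E'\psi)$; and $\varphi$ is the set of $(\mathsf{Vin}_x(M,N),\mathsf{Vin}_x(M',N'))$ with $\mathsf{Tm}(\beta)(N,N')$ and, for all $\psi$ with $x\psi=0$, $\mathsf{Tm}(\alpha^\psi)(M\psi,M'\psi)$ and $\mathsf{Tm}(\beta\psi)(\mathsf{app}(\mathsf{fst}(E\psi),M\psi),N\psi)$. - $\mathrm{Fcom}(\tau)$: all $(\Psi,\mathsf{fcom}^{r\rightsquigarrow r'}(A;r_i=r_i'\hookrightarrow y.B_i),\mathsf{fcom}^{r\rightsquigarrow r'}(A';r_i=r_i'\hookrightarrow y.B_i'),\varphi)$ with $(\dagger)$ and, for some $\alpha,\beta^{\psi,i,j}$: $\mathsf{PTy}(\tau)(\Psi,A,A',\alpha)$,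 $\mathsf{Coh}(\alpha)$; for all $i,j$ and $\psi:\Psi'\to(\Psi,y)$ with $r_i\psi=r_i'\psi$, $r_j\psi=r_j'\psi$, $\mathsf{PTy}(\tau)(\Psi',B_i\psi,B_j'\psi,\beta^{\psi,i,j})$ and $\mathsf{Coh}(\beta^{\psi,i,j})$; for all $i$ and $\psi:\Psi'\to\Psi$ with $r_i\psi=r_i'\psi$, $\mathsf{PTy}(\tau)(\Psi',B_i\langle r/y\rangle\psi,A\psi,\_)$; and $\varphi$ is the set of $(\mathsf{box}^{r\rightsquigarrow r'}(M;r_i=r_i'\hookrightarrow N_i),\mathsf{box}^{r\rightsquigarrow r'}(M';r_i=r_i'\hookrightarrow N_i'))$ with $\mathsf{Tm}(\alpha)(M,M')$; $\mathsf{Tm}(\beta^{\psi,i,j}\langle r'\psi/y\rangle)(N_i\psi,N_j'\psi)$ for all $i,j,\psi:\Psi'\to\Psi$ with $r_i\psi=r_i'\psi$, $r_j\psi=r_j'\psi$ (in $\beta^{\psi,i,j}$, $\psi$ is extended by $y\mapsto y$); and $\mathsf{Tm}(\alpha\psi)(M\psi,\mathsf{coe}_{y.B_i\psi}^{r'\psi\rightsquigarrow r\psi}(N_i\psi))$ for all $i,\psi$ with $r_i\psi=r_i'\psi$. - $\mathrm{Void}=\{(\Psi,\mathsf{void},\mathsf{void},\emptyset)\}$, $\mathrm{Nat}=\{(\Psi,\mathsf{nat},\mathsf{nat},\mathbb N_\Psi)\}$, $\mathrm{Bool}=\{(\Psi,\mathsf{bool},\mathsf{bool},\{(\mathsf{true},\mathsf{true}),(\mathsf{false},\mathsf{false})\})\}$,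 $\mathrm{WB}=\{(\Psi,\mathsf{wbool},\mathsf{wbool},\mathbb B_\Psi)\}$, $\mathrm{Circ}=\{(\Psi,\mathbb S^1,\mathbb S^1,\mathbb C_\Psi)\}$, $\mathrm{UPre}(\nu)$ and $\mathrm{UKan}(\nu)$ are the restrictions of $\nu$ to tuples $(\Psi,\mathcal U^{\mathsf{pre}}_j,\mathcal U^{\mathsf{pre}}_j,\varphi)$, resp. $(\Psi,\mathcal U^{\mathsf{Kan}}_j,\mathcal U^{\mathsf{Kan}}_j,\varphi)$. $P(\nu,\sigma,\tau)$ is the union of $\mathrm{Fun}(\tau),\mathrm{Pair}(\tau),\mathrm{Path}(\tau),\mathrm{Eq}(\tau),\mathrm V(\tau),\mathrm{Fcom}(\sigma),\mathrm{Void},\mathrm{Nat},\mathrm{Bool},\mathrm{WB},\mathrm{Circ},\mathrm{UPre}(\nu),\mathrm{UKan}(\nu)$; $K(\nu,\sigma)$ is the union of $\mathrm{Fun}(\sigma),\mathrm{Pair}(\sigma),\mathrm{Path}(\sigma),\mathrm V(\sigma),\mathrm{Fcom}(\sigma),\mathrm{Void},\mathrm{Nat},\mathrm{Bool},\mathrm{WB},\mathrm{Circ},\mathrm{UKan}(\nu)$. Put $\mu^{\mathsf{pre}}(\nu,\sigma)=\mu\tau.P(\nu,\sigma,\tau)$ and $\mu^{\mathsf{Kan}}(\nu)=\mu\sigma.K(\nu,\sigma)$. By recursion on $n$, $\nu_n=\{(\Psi,\mathcal U^\kappa_j,\mathcal U^\kappa_j,\varphi)\mid j<n,\ \kappa\in\{\mathsf{pre},\mathsf{Kan}\},\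 \varphi=\{(A_0,B_0)\mid\tau^\kappa_j(\Psi,A_0,B_0,\_)\}\}$, $\tau^{\mathsf{Kan}}_n=\mu^{\mathsf{Kan}}(\nu_n)$, $\tau^{\mathsf{pre}}_n=\mu^{\mathsf{pre}}(\nu_n,\mu^{\mathsf{Kan}}(\nu_n))$; $\nu_\omega$ is defined as $\nu_n$ without the condition $j<n$, and $\tau^{\mathsf{Kan}}_\omega=\mu^{\mathsf{Kan}}(\nu_\omega)$, $\tau^{\mathsf{pre}}_\omega=\mu^{\mathsf{pre}}(\nu_\omega,\mu^{\mathsf{Kan}}(\nu_\omega))$. ($\_$ means "for some relation".) **Judgments** relative to $\tau$ (all terms have free dimensions in $\Psi$ and no free variables). $A\doteq B\ \mathsf{type}_{\mathsf{pre}}\,[\Psi]$: $\mathsf{PTy}(\tau)(\Psi,A,B,\alpha)$ and $\mathsf{Coh}(\alpha)$ for some $\alpha$; this $\alpha$ is unique and independent of $B$, and is written $[\![A]\!]$. $M\doteq N\in A\,[\Psi]$ (presupposing $A\doteq A\ \mathsf{type}_{\mathsf{pre}}\,[\Psi]$): $\mathsf{Tm}([\![A]\!])(M,N)$. $M\in A\,[\Psi]$ abbreviates $M\doteq M\in A\,[\Psi]$. -}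

module Defs where

open import Data.Fin using (Fin; zero; suc)
open import Data.List as List using (List; []; _∷_; _++_)
open import Data.List.Relation.Unary.All using (All)
open import Data.Maybe as Maybe using (Maybe; just; nothing)
open import Data.Nat using (ℕ; zero; suc; _<_)
open import Data.Nat.Induction using (<-rec)
open import Data.Product using (∃-syntax; _×_; _,_; proj₁; proj₂; map₂)
open import Data.Unit using (⊤)
open import Data.Vec as Vec using (Vec; []; _∷_; lookup; tail; _[_]≔_)
open import Data.Vec.Properties using (lookup-map; map-lookup-allFin; map-∘)
open import Function using (_⇔_)
open import Relation.Binary.Construct.Closure.ReflexiveTransitive using (Star)
open import Relation.Binary.PropositionalEquality
  using (_≡_; _≢_; refl; sym; trans; cong; subst)
open import Relation.Nullary using (¬_)

-- A finite set Ψ of dimension names is given by its size; names are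
-- de Bruijn indices, the most recently bound one being zero.

data Endpoint : Set where
  0ᵉ 1ᵉ : Endpoint

opposite : Endpoint → Endpoint
opposite 0ᵉ = 1ᵉ
opposite 1ᵉ = 0ᵉ

data Dim (Ψ : ℕ) : Set where
  end  : Endpoint → Dim Ψ
  name : Fin Ψ → Dim Ψ

pattern 𝟎 = end 0ᵉ
pattern 𝟏 = end 1ᵉ
pattern d₀ = name zero
pattern d₁ = name (suc zero)

Eqn : ℕ → Set
Eqn Ψ = Dim Ψ × Dim Ψ

infix 7 _＝_
infix 6 _↪_
pattern _＝_ r r′ = r , r′
pattern _↪_ ξ N = ξ , N

Holds : ∀ {Ψ} → Eqn Ψ → Set
Holds (r ＝ r′) = r ≡ r′

-- DSub Ψ′ Ψ is the type of dimension substitutions ψ : Ψ′ → Ψ.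
DSub : ℕ → ℕ → Set
DSub Ψ′ Ψ = Vec (Dim Ψ′) Ψ

infixl 8 _⟨_⟩ᵈ _⟨_⟩ᵉ _↑ᵈ _↑ᵉ

_⟨_⟩ᵈ : ∀ {Ψ Ψ′} → Dim Ψ → DSub Ψ′ Ψ → Dim Ψ′
end ε  ⟨ ψ ⟩ᵈ = end ε
name x ⟨ ψ ⟩ᵈ = lookup ψ x

_⟨_⟩ᵉ : ∀ {Ψ Ψ′} → Eqn Ψ → DSub Ψ′ Ψ → Eqn Ψ′
(r ＝ r′) ⟨ ψ ⟩ᵉ = r ⟨ ψ ⟩ᵈ ＝ r′ ⟨ ψ ⟩ᵈ

_↑ᵈ : ∀ {Ψ} → Dim Ψ → Dim (suc Ψ)
end ε  ↑ᵈ = end ε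
name x ↑ᵈ = name (suc x)

_↑ᵉ : ∀ {Ψ} → Eqn Ψ → Eqn (suc Ψ)
(r ＝ r′) ↑ᵉ = r ↑ᵈ ＝ r′ ↑ᵈ

id : ∀ {Ψ} → DSub Ψ Ψ
id = Vec.map name (Vec.allFin _)

wk : ∀ {Ψ} → DSub (suc Ψ) Ψ
wk = Vec.map _↑ᵈ id

lift : ∀ {Ψ Ψ′} → DSub Ψ′ Ψ → DSub (suc Ψ′) (suc Ψ)
lift ψ = d₀ ∷ Vec.map _↑ᵈ ψ

swap : ∀ {Ψ} → DSub (suc (suc Ψ)) (suc (suc Ψ))
swap = d₁ ∷ d₀ ∷ Vec.map _↑ᵈ wk

-- M ⟨ abs y ⟩ is the body of y.M, for y a name already in scope.
abs : ∀ {Ψ} → Fin Ψ → DSub (suc Ψ) Ψ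
abs y = wk [ y ]≔ d₀

-- ψ₁ ⨟ ψ₂ is first ψ₁, then ψ₂.
infixl 8 _⨟_
_⨟_ : ∀ {Ψ Ψ₁ Ψ₂} → DSub Ψ₁ Ψ → DSub Ψ₂ Ψ₁ → DSub Ψ₂ Ψ
ψ₁ ⨟ ψ₂ = Vec.map (_⟨ ψ₂ ⟩ᵈ) ψ₁

id-⨟ : ∀ {Ψ Ψ′} (ψ : DSub Ψ′ Ψ) → id ⨟ ψ ≡ ψ
id-⨟ ψ = trans (sym (map-∘ (_⟨ ψ ⟩ᵈ) name (Vec.allFin _))) (map-lookup-allFin ψ)

strengthenᵈ : ∀ {Ψ} → Dim (suc Ψ) → Maybe (Dim Ψ)
strengthenᵈ (end ε)        = just (end ε)
strengthenᵈ (name zero)    = nothing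
strengthenᵈ (name (suc x)) = just (name x)

-- Keeps only the entries in whose equation the newest name does not occur.
fresh : ∀ {Ψ} {X : Set} → List (Eqn (suc Ψ) × X) → List (Eqn Ψ × X)
fresh = List.mapMaybe λ where
  ((r ＝ r′) ↪ N) →
    Maybe.zipWith (λ s s′ → s ＝ s′ ↪ N) (strengthenᵈ r) (strengthenᵈ r′)

↑ᵈ-lift : ∀ {Ψ Ψ′} (ψ : DSub Ψ′ Ψ) (r : Dim Ψ) →
          r ⟨ tail (lift ψ) ⟩ᵈ ≡ (r ⟨ ψ ⟩ᵈ) ↑ᵈ
↑ᵈ-lift ψ (end ε)  = refl
↑ᵈ-lift ψ (name x) = lookup-map x _↑ᵈ ψ

Holds-lift : ∀ {Ψ Ψ′} (ψ : DSub Ψ′ Ψ) (ξ : Eqn Ψ) →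
             Holds (ξ ⟨ ψ ⟩ᵉ) → Holds (ξ ⟨ tail (lift ψ) ⟩ᵉ)
Holds-lift ψ (r ＝ r′) p =
  trans (↑ᵈ-lift ψ r) (trans (cong _↑ᵈ p) (sym (↑ᵈ-lift ψ r′)))

data Kind : Set where
  pre Kan : Kind

-- Term Ψ Γ: free dimension names among Ψ, free term variables among Γ.
-- Under "n.a." the variable a is zero and n is suc zero.
data Term (Ψ Γ : ℕ) : Set where
  var    : Fin Γ → Term Ψ Γ
  pi     : Term Ψ Γ → Term Ψ (suc Γ) → Term Ψ Γ
  sg     : Term Ψ Γ → Term Ψ (suc Γ) → Term Ψ Γ
  path   : Term (suc Ψ) Γ → Term Ψ Γ → Term Ψ Γ → Term Ψ Γ
  eq     : Term Ψ Γ → Term Ψ Γ → Term Ψ Γ → Term Ψ Γ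
  void nat bool wbool S¹ : Term Ψ Γ
  U      : Kind → ℕ → Term Ψ Γ
  V      : Dim Ψ → Term Ψ Γ → Term Ψ Γ → Term Ψ Γ → Term Ψ Γ
  Vin    : Dim Ψ → Term Ψ Γ → Term Ψ Γ → Term Ψ Γ
  Vproj  : Dim Ψ → Term Ψ Γ → Term Ψ Γ → Term Ψ Γ
  lam    : Term Ψ (suc Γ) → Term Ψ Γ
  app    : Term Ψ Γ → Term Ψ Γ → Term Ψ Γ
  pair   : Term Ψ Γ → Term Ψ Γ → Term Ψ Γ
  fst    : Term Ψ Γ → Term Ψ Γ
  snd    : Term Ψ Γ → Term Ψ Γ
  dlam   : Term (suc Ψ) Γ → Term Ψ Γ
  _＠_   : Term Ψ Γ → Dim Ψ → Term Ψ Γ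
  ⋆      : Term Ψ Γ
  ze     : Term Ψ Γ
  su     : Term Ψ Γ → Term Ψ Γ
  natrec : Term Ψ Γ → Term Ψ Γ → Term Ψ (suc (suc Γ)) → Term Ψ Γ
  true false : Term Ψ Γ
  if     : Term Ψ (suc Γ) → Term Ψ Γ → Term Ψ Γ → Term Ψ Γ → Term Ψ Γ
  base   : Term Ψ Γ
  loop   : Dim Ψ → Term Ψ Γ
  S¹elim : Term Ψ (suc Γ) → Term Ψ Γ → Term Ψ Γ → Term (suc Ψ) Γ → Term Ψ Γ
  coe    : Term (suc Ψ) Γ → Dim Ψ → Dim Ψ → Term Ψ Γ → Term Ψ Γ
  hcom   : Term Ψ Γ → Dim Ψ → Dim Ψ → Term Ψ Γ →
           List (Eqn Ψ × Term (suc Ψ) Γ) → Term Ψ Γ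
  com    : Term (suc Ψ) Γ → Dim Ψ → Dim Ψ → Term Ψ Γ →
           List (Eqn Ψ × Term (suc Ψ) Γ) → Term Ψ Γ
  fcom   : Dim Ψ → Dim Ψ → Term Ψ Γ →
           List (Eqn Ψ × Term (suc Ψ) Γ) → Term Ψ Γ
  ghcom  : Term Ψ Γ → Dim Ψ → Dim Ψ → Term Ψ Γ →
           List (Eqn Ψ × Term (suc Ψ) Γ) → Term Ψ Γ
  gcom   : Term (suc Ψ) Γ → Dim Ψ → Dim Ψ → Term Ψ Γ →
           List (Eqn Ψ × Term (suc Ψ) Γ) → Term Ψ Γ
  box    : Dim Ψ → Dim Ψ → Term Ψ Γ → List (Eqn Ψ × Term Ψ Γ) → Term Ψ Γ
  cap    : Dim Ψ → Dim Ψ → Term Ψ Γ →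
           List (Eqn Ψ × Term (suc Ψ) Γ) → Term Ψ Γ

infixl 8 _＠_

Tubes : ℕ → ℕ → Set
Tubes Ψ Γ = List (Eqn Ψ × Term (suc Ψ) Γ)

Sides : ℕ → ℕ → Set
Sides Ψ Γ = List (Eqn Ψ × Term Ψ Γ)

-- Terms without free variables: M tm [Ψ].
Tm₀ : ℕ → Set
Tm₀ Ψ = Term Ψ 0

-- The data needed to substitute elements of ◆ for term variables; it is
-- used with ◆ = Fin (renaming) and with ◆ = Term (substitution).
record Kit (◆ : ℕ → ℕ → Set) : Set where
  field
    fromVar : ∀ {Ψ Γ} → Fin Γ → ◆ Ψ Γ
    toTerm  : ∀ {Ψ Γ} → ◆ Ψ Γ → Term Ψ Γ
    wkVar   : ∀ {Ψ Γ} → ◆ Ψ Γ → ◆ Ψ (suc Γ)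
    wkDim   : ∀ {Ψ Γ} → ◆ Ψ Γ → ◆ (suc Ψ) Γ

module Traversal {◆ : ℕ → ℕ → Set} (K : Kit ◆) where
  open Kit K

  liftᵛ : ∀ {Ψ Γ Γ′} → Vec (◆ Ψ Γ′) Γ → Vec (◆ Ψ (suc Γ′)) (suc Γ)
  liftᵛ σ = fromVar zero ∷ Vec.map wkVar σ

  under : ∀ {Ψ Γ Γ′} → Vec (◆ Ψ Γ′) Γ → Vec (◆ (suc Ψ) Γ′) Γ
  under = Vec.map wkDim

  trav  : ∀ {Ψ Ψ′ Γ Γ′} → DSub Ψ′ Ψ → Vec (◆ Ψ′ Γ′) Γ → Term Ψ Γ → Term Ψ′ Γ′
  travᵀ : ∀ {Ψ Ψ′ Γ Γ′} → DSub Ψ′ Ψ → Vec (◆ Ψ′ Γ′) Γ → Tubes Ψ Γ → Tubes Ψ′ Γ′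
  travˢ : ∀ {Ψ Ψ′ Γ Γ′} → DSub Ψ′ Ψ → Vec (◆ Ψ′ Γ′) Γ → Sides Ψ Γ → Sides Ψ′ Γ′

  trav ψ σ (var a)          = toTerm (lookup σ a)
  trav ψ σ (pi A B)         = pi (trav ψ σ A) (trav ψ (liftᵛ σ) B)
  trav ψ σ (sg A B)         = sg (trav ψ σ A) (trav ψ (liftᵛ σ) B)
  trav ψ σ (path A M N)     = path (trav (lift ψ) (under σ) A) (trav ψ σ M) (trav ψ σ N)
  trav ψ σ (eq A M N)       = eq (trav ψ σ A) (trav ψ σ M) (trav ψ σ N)
  trav ψ σ void             = void
  trav ψ σ nat              = nat
  trav ψ σ bool             = bool
  trav ψ σ wbool            = wbool
  trav ψ σ S¹               = S¹
  trav ψ σ (U κ j)          = U κ j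
  trav ψ σ (V r A B E)      = V (r ⟨ ψ ⟩ᵈ) (trav ψ σ A) (trav ψ σ B) (trav ψ σ E)
  trav ψ σ (Vin r M N)      = Vin (r ⟨ ψ ⟩ᵈ) (trav ψ σ M) (trav ψ σ N)
  trav ψ σ (Vproj r M F)    = Vproj (r ⟨ ψ ⟩ᵈ) (trav ψ σ M) (trav ψ σ F)
  trav ψ σ (lam M)          = lam (trav ψ (liftᵛ σ) M)
  trav ψ σ (app M N)        = app (trav ψ σ M) (trav ψ σ N)
  trav ψ σ (pair M N)       = pair (trav ψ σ M) (trav ψ σ N)
  trav ψ σ (fst M)          = fst (trav ψ σ M)
  trav ψ σ (snd M)          = snd (trav ψ σ M)
  trav ψ σ (dlam M)         = dlam (trav (lift ψ) (under σ) M)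
  trav ψ σ (M ＠ r)         = trav ψ σ M ＠ (r ⟨ ψ ⟩ᵈ)
  trav ψ σ ⋆                = ⋆
  trav ψ σ ze               = ze
  trav ψ σ (su M)           = su (trav ψ σ M)
  trav ψ σ (natrec M Z S)   =
    natrec (trav ψ σ M) (trav ψ σ Z) (trav ψ (liftᵛ (liftᵛ σ)) S)
  trav ψ σ true             = true
  trav ψ σ false            = false
  trav ψ σ (if A M T F)     =
    if (trav ψ (liftᵛ σ) A) (trav ψ σ M) (trav ψ σ T) (trav ψ σ F)
  trav ψ σ base             = base
  trav ψ σ (loop r)         = loop (r ⟨ ψ ⟩ᵈ)
  trav ψ σ (S¹elim A M P L) =
    S¹elim (trav ψ (liftᵛ σ) A) (trav ψ σ M) (trav ψ σ P) (trav (lift ψ) (under σ) L)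
  trav ψ σ (coe A r r′ M)   =
    coe (trav (lift ψ) (under σ) A) (r ⟨ ψ ⟩ᵈ) (r′ ⟨ ψ ⟩ᵈ) (trav ψ σ M)
  trav ψ σ (hcom A r r′ M T) =
    hcom (trav ψ σ A) (r ⟨ ψ ⟩ᵈ) (r′ ⟨ ψ ⟩ᵈ) (trav ψ σ M) (travᵀ ψ σ T)
  trav ψ σ (com A r r′ M T) =
    com (trav (lift ψ) (under σ) A) (r ⟨ ψ ⟩ᵈ) (r′ ⟨ ψ ⟩ᵈ) (trav ψ σ M) (travᵀ ψ σ T)
  trav ψ σ (fcom r r′ M T)  =
    fcom (r ⟨ ψ ⟩ᵈ) (r′ ⟨ ψ ⟩ᵈ) (trav ψ σ M) (travᵀ ψ σ T)
  trav ψ σ (ghcom A r r′ M T) =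
    ghcom (trav ψ σ A) (r ⟨ ψ ⟩ᵈ) (r′ ⟨ ψ ⟩ᵈ) (trav ψ σ M) (travᵀ ψ σ T)
  trav ψ σ (gcom A r r′ M T) =
    gcom (trav (lift ψ) (under σ) A) (r ⟨ ψ ⟩ᵈ) (r′ ⟨ ψ ⟩ᵈ) (trav ψ σ M) (travᵀ ψ σ T)
  trav ψ σ (box r r′ M Ns)  =
    box (r ⟨ ψ ⟩ᵈ) (r′ ⟨ ψ ⟩ᵈ) (trav ψ σ M) (travˢ ψ σ Ns)
  trav ψ σ (cap r r′ M T)   =
    cap (r ⟨ ψ ⟩ᵈ) (r′ ⟨ ψ ⟩ᵈ) (trav ψ σ M) (travᵀ ψ σ T)

  travᵀ ψ σ []            = []
  travᵀ ψ σ (ξ ↪ N ∷ T)   = ξ ⟨ ψ ⟩ᵉ ↪ trav (lift ψ) (under σ) N ∷ travᵀ ψ σ T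

  travˢ ψ σ []            = []
  travˢ ψ σ (ξ ↪ N ∷ Ns)  = ξ ⟨ ψ ⟩ᵉ ↪ trav ψ σ N ∷ travˢ ψ σ Ns

renaming-kit : Kit (λ _ Γ → Fin Γ)
renaming-kit = record
  { fromVar = λ a → a ; toTerm = var ; wkVar = suc ; wkDim = λ a → a }

module Renaming = Traversal renaming-kit

infixl 8 _⟨_⟩ _⟨_⟩ᵀ _↑ _↑ᵀ _↑₁ _⇑ _[_]

_⟨_⟩ : ∀ {Ψ Ψ′ Γ} → Term Ψ Γ → DSub Ψ′ Ψ → Term Ψ′ Γ
M ⟨ ψ ⟩ = Renaming.trav ψ (Vec.allFin _) M

_⟨_⟩ᵀ : ∀ {Ψ Ψ′ Γ} → Tubes Ψ Γ → DSub Ψ′ Ψ → Tubes Ψ′ Γ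
T ⟨ ψ ⟩ᵀ = Renaming.travᵀ ψ (Vec.allFin _) T

_↑ : ∀ {Ψ Γ} → Term Ψ Γ → Term (suc Ψ) Γ
M ↑ = M ⟨ wk ⟩

_↑ᵀ : ∀ {Ψ Γ} → Tubes Ψ Γ → Tubes (suc Ψ) Γ
T ↑ᵀ = T ⟨ wk ⟩ᵀ

-- Weakening of y.M: the new name is inserted just below the bound name y.
_↑₁ : ∀ {Ψ Γ} → Term (suc Ψ) Γ → Term (suc (suc Ψ)) Γ
M ↑₁ = M ⟨ lift wk ⟩

_⇑ : ∀ {Ψ Γ} → Term Ψ Γ → Term Ψ (suc Γ)
M ⇑ = Renaming.trav id (Vec.map suc (Vec.allFin _)) M

substitution-kit : Kit Term
substitution-kit = record
  { fromVar = var ; toTerm = λ M → M ; wkVar = _⇑ ; wkDim = _↑ }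

_[_] : ∀ {Ψ Γ Γ′} → Term Ψ Γ → Vec (Term Ψ Γ′) Γ → Term Ψ Γ′
M [ σ ] = Traversal.trav substitution-kit id σ M

mapᵀ : ∀ {Ψ Ψ′ Γ Γ′} → (Term Ψ Γ → Term Ψ′ Γ′) →
       ∀ {X : Set} → List (X × Term Ψ Γ) → List (X × Term Ψ′ Γ′)
mapᵀ f = List.map (map₂ f)

NoneHolds : ∀ {Ψ} {X : Set} → List (Eqn Ψ × X) → Set
NoneHolds = All (λ e → ¬ Holds (proj₁ e))

isContr : ∀ {Ψ Γ} → Term Ψ Γ → Term Ψ Γ
isContr C =
  sg C (pi C (pi (C ⇑) (path (C ⇑ ⇑ ↑) (var (suc zero)) (var zero))) ⇑)

Equiv : ∀ {Ψ Γ} → Term Ψ Γ → Term Ψ Γ → Term Ψ Γ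
Equiv A B =
  sg (pi A (B ⇑))
     (pi (B ⇑)
         (isContr (sg (A ⇑ ⇑)
                      (path (B ⇑ ⇑ ⇑ ↑) (app (var (suc (suc zero))) (var zero))
                            (var (suc zero))))))

data Val {Ψ} : Tm₀ Ψ → Set where
  pi    : ∀ {A B} → Val (pi A B)
  sg    : ∀ {A B} → Val (sg A B)
  path  : ∀ {A M N} → Val (path A M N)
  eq    : ∀ {A M N} → Val (eq A M N)
  void  : Val void
  nat   : Val nat
  bool  : Val bool
  wbool : Val wbool
  S¹    : Val S¹
  U     : ∀ {κ j} → Val (U κ j)
  V     : ∀ {x A B E} → Val (V (name x) A B E)
  lam   : ∀ {M} → Val (lam M)
  pair  : ∀ {M N} → Val (pair M N)
  dlam  : ∀ {M} → Val (dlam M)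
  ⋆     : Val ⋆
  ze    : Val ze
  su    : ∀ {M} → Val (su M)
  true  : Val true
  false : Val false
  base  : Val base
  loop  : ∀ {x} → Val (loop (name x))
  Vin   : ∀ {x M N} → Val (Vin (name x) M N)
  fcom  : ∀ {r r′ M T} → r ≢ r′ → NoneHolds T → Val (fcom r r′ M T)
  box   : ∀ {r r′ M Ns} → r ≢ r′ → NoneHolds Ns → Val (box r r′ M Ns)

-- The right-hand side of the rule for coe^{y⇝r′} in x.V_x(A,B,E), with
-- y a name other than x; the newest name of A, B, E is x.
module CoeV {Ψ} (A B E : Tm₀ (suc Ψ)) (y : Fin Ψ) (r′ : Dim Ψ) (M : Tm₀ Ψ) where

  A₀ B₀ E₀ : Tm₀ Ψ
  A₀ = A ⟨ 𝟎 ∷ id ⟩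
  B₀ = B ⟨ 𝟎 ∷ id ⟩
  E₀ = E ⟨ 𝟎 ∷ id ⟩

  -- w.O_ε
  O : Endpoint → Tm₀ (suc Ψ)
  O ε = Vproj d₀ (coe (V d₀ A B E ↑₁) (end ε) d₀ (M ↑)) (fst E)

  -- x.P
  P : Tm₀ (suc Ψ)
  P = com (B ↑₁) (name (suc y)) d₀ (Vproj (name y) M (fst (E ⟨ name y ∷ id ⟩)) ↑)
        ( name (suc y) ＝ 𝟎 ↪ O 0ᵉ ↑₁
        ∷ name (suc y) ＝ 𝟏 ↪ O 1ᵉ ↑₁
        ∷ [])

  P₀ : Tm₀ Ψ
  P₀ = P ⟨ 𝟎 ∷ id ⟩

  Q : Endpoint → Tm₀ Ψ → Tm₀ Ψ
  Q ε a =
    pair coeA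
      (dlam (com (B₀ ⟨ abs y ⟩ ↑₁) (end ε) (name (suc y)) (P₀ ⟨ id [ y ]≔ end ε ⟩ ↑)
               ( d₀ ＝ 𝟎 ↪ app (fst E₀) coeA ⟨ abs y ⟩ ↑₁
               ∷ d₀ ＝ 𝟏 ↪ P₀ ⟨ abs y ⟩ ↑₁
               ∷ [])))
    where
    coeA : Tm₀ Ψ
    coeA = coe (A₀ ⟨ abs y ⟩) (end ε) (name y) a

  R : Tm₀ Ψ
  R = app (app (snd (app (snd E₀) P₀))
               (Q 0ᵉ (M ⟨ id [ y ]≔ 𝟎 ⟩)))
          (Q 1ᵉ (coe (V d₀ A B E) 𝟏 𝟎 M ⟨ id [ y ]≔ 𝟏 ⟩))
      ＠ name y

  result : Tm₀ Ψ
  result =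
    Vin r′ (fst R)
      (hcom (B ⟨ r′ ∷ id ⟩) 𝟏 𝟎 (P ⟨ r′ ∷ id ⟩)
        ( name y ＝ 𝟎      ↪ O 0ᵉ ⟨ r′ ∷ id ⟩ ↑
        ∷ name y ＝ 𝟏      ↪ O 1ᵉ ⟨ r′ ∷ id ⟩ ↑
        ∷ name y ＝ r′     ↪ Vproj r′ M (fst (E ⟨ r′ ∷ id ⟩)) ↑
        ∷ r′     ＝ 𝟎      ↪ snd R ↑ ＠ d₀
        ∷ []))

-- hcom in fcom^{s⇝s′}(A; s_j = s_j′ ↪ z.B_j).
module HcomFcom {Ψ} (s s′ : Dim Ψ) (A : Tm₀ Ψ) (Bs : Tubes Ψ 0)
                (r r′ : Dim Ψ) (M : Tm₀ Ψ) (T : Tubes Ψ 0) where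

  -- z.P_j, given z.B_j
  P : Tm₀ (suc Ψ) → Tm₀ (suc Ψ)
  P B = hcom B (r ↑ᵈ) (r′ ↑ᵈ) (coe (B ↑₁) (s′ ↑ᵈ) d₀ (M ↑))
          (List.map (λ where
             (ξ ↪ N) → ξ ↑ᵉ ↪ coe (B ↑₁ ↑₁) (s′ ↑ᵈ ↑ᵈ) d₁ (N ↑₁)) T)

  -- z.F[c]; the context is general because F is also used under a tube binder.
  F : ∀ {Φ} → Dim Φ → Dim Φ → Tm₀ Φ → Tubes Φ 0 → Tm₀ Φ → Tm₀ (suc Φ)
  F s s′ A Bs c =
    hcom (A ↑) (s′ ↑ᵈ) d₀ (cap s s′ c Bs ↑)
      (List.map (λ where
         (ξ ↪ B) → ξ ↑ᵉ ↪ coe (B ↑₁ ↑₁) d₀ (s ↑ᵈ ↑ᵈ)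
                             (coe (B ↑₁ ↑₁) (s′ ↑ᵈ ↑ᵈ) d₀ (c ↑ ↑))) Bs)

  FM : Tm₀ (suc Ψ)
  FM = F s s′ A Bs M

  O : Tm₀ Ψ
  O = hcom A r r′ (FM ⟨ s ∷ id ⟩)
        (mapᵀ (λ N → F (s ↑ᵈ) (s′ ↑ᵈ) (A ↑) (Bs ↑ᵀ) N ⟨ s ↑ᵈ ∷ id ⟩) T)

  Q : Tm₀ Ψ
  Q = hcom A s s′ O
        ( mapᵀ (λ N → F s s′ A Bs (N ⟨ r′ ∷ id ⟩)) T
       ++ mapᵀ (λ B → coe (B ↑₁) d₀ (s ↑ᵈ) (P B)) Bs
       ++ r ＝ r′ ↪ FM
        ∷ [])

  result : Tm₀ Ψ
  result = box s s′ Q (mapᵀ (λ B → P B ⟨ s′ ∷ id ⟩) Bs)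

-- coe in x.fcom^{s⇝s′}(A; s_i = s_i′ ↪ z.B_i); the newest name of s, s′,
-- A, Bs is x.
module CoeFcom {Ψ} (s s′ : Dim (suc Ψ)) (A : Tm₀ (suc Ψ)) (Bs : Tubes (suc Ψ) 0)
               (r r′ : Dim Ψ) (M : Tm₀ Ψ) where

  -- x.z.N_i, given x.z.B_i
  N : Tm₀ (suc (suc Ψ)) → Tm₀ (suc (suc Ψ))
  N B = coe (B ↑₁) (s′ ↑ᵈ) d₀ (coe (B ⟨ s′ ∷ id ⟩ ↑₁) (r ↑ᵈ) d₀ (M ↑) ↑)

  -- z.O
  O : Tm₀ (suc Ψ)
  O = hcom (A ↑) (s′ ↑ᵈ) d₀ (cap s s′ (M ↑) Bs ↑)
        (mapᵀ (λ B → coe (B ↑₁) d₀ (s ↑ᵈ) (N B)) Bs ↑ᵀ)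
      ⟨ lift (r ∷ id) ⟩

  P : Tm₀ Ψ
  P = gcom A r r′ (O ⟨ s ⟨ r ∷ id ⟩ᵈ ∷ id ⟩)
        (fresh ( mapᵀ (λ B → N B ⟨ s ∷ id ⟩) Bs
              ++ s ＝ s′ ↪ coe (A ↑₁) (r ↑ᵈ) d₀ (M ↑)
               ∷ []))

  -- z.Q_k, given x.z.B_k
  Q : Tm₀ (suc (suc Ψ)) → Tm₀ (suc Ψ)
  Q B = gcom (B ⟨ lift (r′ ∷ id) ⟩ ↑₁) (s ⟨ r′ ∷ id ⟩ᵈ ↑ᵈ) d₀ (P ↑)
          (( fresh (mapᵀ (λ B′ → N B′ ⟨ lift (r′ ∷ id) ⟩) Bs)
          ++ r ＝ r′ ↪ N B ⟨ lift (r′ ∷ id) ⟩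
           ∷ []) ↑ᵀ)

  result : Tm₀ Ψ
  result =
    box s s′
      (hcom A s s′ (P ↑)
        ( mapᵀ (λ B → coe (B ↑₁) d₀ (s ↑ᵈ) (Q B ↑₁)) Bs
       ++ (r ↑ᵈ) ＝ (r′ ↑ᵈ) ↪ O ↑₁
        ∷ []))
      (mapᵀ (λ B → Q B ↑₁ ⟨ s′ ∷ id ⟩) Bs)
    ⟨ r′ ∷ id ⟩

infix 3 _⟼_ _⟼*_ _⇓_

data _⟼_ {Ψ} : Tm₀ Ψ → Tm₀ Ψ → Set where

  hcom-cong   : ∀ {A A′ r r′ M T} → A ⟼ A′ → hcom A r r′ M T ⟼ hcom A′ r r′ M T
  coe-cong    : ∀ {A A′ r r′ M} → A ⟼ A′ → coe A r r′ M ⟼ coe A′ r r′ M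
  app-cong    : ∀ {M M′ N} → M ⟼ M′ → app M N ⟼ app M′ N
  fst-cong    : ∀ {M M′} → M ⟼ M′ → fst M ⟼ fst M′
  snd-cong    : ∀ {M M′} → M ⟼ M′ → snd M ⟼ snd M′
  ＠-cong     : ∀ {M M′ r} → M ⟼ M′ → M ＠ r ⟼ M′ ＠ r
  natrec-cong : ∀ {M M′ Z S} → M ⟼ M′ → natrec M Z S ⟼ natrec M′ Z S
  if-cong     : ∀ {A M M′ T F} → M ⟼ M′ → if A M T F ⟼ if A M′ T F
  S¹elim-cong : ∀ {A M M′ P L} → M ⟼ M′ → S¹elim A M P L ⟼ S¹elim A M′ P L
  Vproj-cong  : ∀ {x M M′ F} → M ⟼ M′ → Vproj (name x) M F ⟼ Vproj (name x) M′ F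
  cap-cong    : ∀ {r r′ M M′ T} → r ≢ r′ → NoneHolds T → M ⟼ M′ →
                cap r r′ M T ⟼ cap r r′ M′ T

  com-β  : ∀ {A r r′ M T} →
           com A r r′ M T ⟼
           hcom (A ⟨ r′ ∷ id ⟩) r r′ (coe A r r′ M)
             (mapᵀ (λ N → coe (A ↑₁) d₀ (r′ ↑ᵈ) N) T)
  gcom-β : ∀ {A r r′ M T} →
           gcom A r r′ M T ⟼
           ghcom (A ⟨ r′ ∷ id ⟩) r r′ (coe A r r′ M)
             (mapᵀ (λ N → coe (A ↑₁) d₀ (r′ ↑ᵈ) N) T)

  -- The decomposition of the list singles out the least j with r_j = r_j′.
  fcom-cap  : ∀ {r M T} → fcom r r M T ⟼ M
  fcom-tube : ∀ {r r′ M T₁ s N T₂} → r ≢ r′ → NoneHolds T₁ →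
              fcom r r′ M (T₁ ++ s ＝ s ↪ N ∷ T₂) ⟼ N ⟨ r′ ∷ id ⟩

  ghcom-[] : ∀ {A r r′ M} → ghcom A r r′ M [] ⟼ M
  ghcom-∷  : ∀ {A r r′ M s s′ N T} →
    let tube : Endpoint → Tm₀ (suc Ψ)
        tube ε = hcom (A ↑) (r ↑ᵈ) d₀ (M ↑)
                   ( (s′ ↑ᵈ) ＝ end ε ↪ N ↑₁
                   ∷ (s′ ↑ᵈ) ＝ end (opposite ε) ↪
                       ghcom (A ↑ ↑) (r ↑ᵈ ↑ᵈ) d₀ (M ↑ ↑) (T ↑ᵀ ↑ᵀ)
                   ∷ T ↑ᵀ)
    in ghcom A r r′ M (s ＝ s′ ↪ N ∷ T) ⟼
       hcom A r r′ M (s ＝ 𝟎 ↪ tube 0ᵉ ∷ s ＝ 𝟏 ↪ tube 1ᵉ ∷ s ＝ s′ ↪ N ∷ T)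

  app-lam : ∀ {M N} → app (lam M) N ⟼ M [ N ∷ [] ]
  hcom-pi : ∀ {A B r r′ M T} →
    hcom (pi A B) r r′ M T ⟼
    lam (hcom B r r′ (app (M ⇑) (var zero)) (mapᵀ (λ N → app (N ⇑) (var zero)) T))
  coe-pi  : ∀ {A B r r′ M} →
    coe (pi A B) r r′ M ⟼
    lam (coe (B [ coe (A ↑₁ ⇑) (r′ ↑ᵈ) d₀ (var zero) ∷ [] ]) r r′
             (app (M ⇑) (coe (A ⇑) r′ r (var zero))))

  fst-pair : ∀ {M N} → fst (pair M N) ⟼ M
  snd-pair : ∀ {M N} → snd (pair M N) ⟼ N
  hcom-sg  : ∀ {A B r r′ M T} →
    let F : Tm₀ (suc Ψ)
        F = hcom (A ↑) (r ↑ᵈ) d₀ (fst M ↑) (mapᵀ fst T ↑ᵀ)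
    in hcom (sg A B) r r′ M T ⟼
       pair (hcom A r r′ (fst M) (mapᵀ fst T))
            (com (B ↑ [ F ∷ [] ]) r r′ (snd M) (mapᵀ snd T))
  coe-sg   : ∀ {A B r r′ M} →
    coe (sg A B) r r′ M ⟼
    pair (coe A r r′ (fst M))
         (coe (B [ coe (A ↑₁) (r ↑ᵈ) d₀ (fst M ↑) ∷ [] ]) r r′ (snd M))

  dlam-＠   : ∀ {M r} → dlam M ＠ r ⟼ M ⟨ r ∷ id ⟩
  hcom-path : ∀ {A P₀ P₁ r r′ M T} →
    hcom (path A P₀ P₁) r r′ M T ⟼
    dlam (hcom A (r ↑ᵈ) (r′ ↑ᵈ) (M ↑ ＠ d₀)
           ( d₀ ＝ 𝟎 ↪ P₀ ↑ ↑
           ∷ d₀ ＝ 𝟏 ↪ P₁ ↑ ↑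
           ∷ mapᵀ (_＠ d₁) (T ↑ᵀ)))
  coe-path  : ∀ {A P₀ P₁ r r′ M} →
    coe (path A P₀ P₁) r r′ M ⟼
    dlam (com (A ⟨ swap ⟩) (r ↑ᵈ) (r′ ↑ᵈ) (M ↑ ＠ d₀)
           ( d₀ ＝ 𝟎 ↪ P₀ ↑₁
           ∷ d₀ ＝ 𝟏 ↪ P₁ ↑₁
           ∷ []))

  hcom-eq : ∀ {A E₀ E₁ r r′ M T} → hcom (eq A E₀ E₁) r r′ M T ⟼ ⋆

  natrec-ze  : ∀ {Z S} → natrec ze Z S ⟼ Z
  natrec-su  : ∀ {M Z S} → natrec (su M) Z S ⟼ S [ natrec M Z S ∷ M ∷ [] ]
  if-true    : ∀ {A T F} → if A true T F ⟼ T
  if-false   : ∀ {A T F} → if A false T F ⟼ F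
  hcom-nat   : ∀ {r r′ M T} → hcom nat r r′ M T ⟼ M
  hcom-bool  : ∀ {r r′ M T} → hcom bool r r′ M T ⟼ M
  coe-nat    : ∀ {r r′ M} → coe nat r r′ M ⟼ M
  coe-bool   : ∀ {r r′ M} → coe bool r r′ M ⟼ M
  coe-wbool  : ∀ {r r′ M} → coe wbool r r′ M ⟼ M
  coe-S¹     : ∀ {r r′ M} → coe S¹ r r′ M ⟼ M
  hcom-wbool : ∀ {r r′ M T} → hcom wbool r r′ M T ⟼ fcom r r′ M T
  hcom-S¹    : ∀ {r r′ M T} → hcom S¹ r r′ M T ⟼ fcom r r′ M T
  loop-end   : ∀ {ε} → loop (end ε) ⟼ base
  S¹elim-base : ∀ {A P L} → S¹elim A base P L ⟼ P
  S¹elim-loop : ∀ {A w P L} → S¹elim A (loop (name w)) P L ⟼ L ⟨ name w ∷ id ⟩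
  if-fcom     : ∀ {A r r′ M N T F} → r ≢ r′ → NoneHolds N →
    let H : Tm₀ (suc Ψ)
        H = fcom (r ↑ᵈ) d₀ (M ↑) (N ↑ᵀ)
    in if A (fcom r r′ M N) T F ⟼
       com (A ↑ [ H ∷ [] ]) r r′ (if A M T F)
         (mapᵀ (λ Nᵢ → if (A ↑) Nᵢ (T ↑) (F ↑)) N)
  S¹elim-fcom : ∀ {A r r′ M N P L} → r ≢ r′ → NoneHolds N →
    let H : Tm₀ (suc Ψ)
        H = fcom (r ↑ᵈ) d₀ (M ↑) (N ↑ᵀ)
    in S¹elim A (fcom r r′ M N) P L ⟼
       com (A ↑ [ H ∷ [] ]) r r′ (S¹elim A M P L)
         (mapᵀ (λ Nᵢ → S¹elim (A ↑) Nᵢ (P ↑) (L ↑₁)) N)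

  V-0       : ∀ {A B E} → V 𝟎 A B E ⟼ A
  V-1       : ∀ {A B E} → V 𝟏 A B E ⟼ B
  Vin-0     : ∀ {M N} → Vin 𝟎 M N ⟼ M
  Vin-1     : ∀ {M N} → Vin 𝟏 M N ⟼ N
  Vproj-0   : ∀ {M F} → Vproj 𝟎 M F ⟼ app F M
  Vproj-1   : ∀ {M F} → Vproj 𝟏 M F ⟼ M
  Vproj-Vin : ∀ {x M N F} → Vproj (name x) (Vin (name x) M N) F ⟼ N
  hcom-V    : ∀ {x A B E r r′ M T} →
    let O : Tm₀ (suc Ψ)
        O = hcom (A ↑) (r ↑ᵈ) d₀ (M ↑) (T ↑ᵀ)
    in hcom (V (name x) A B E) r r′ M T ⟼
       Vin (name x) (O ⟨ r′ ∷ id ⟩)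
         (hcom B r r′ (Vproj (name x) M (fst E))
           ( mapᵀ (λ N → Vproj (name (suc x)) N (fst E ↑)) T
          ++ name x ＝ 𝟎 ↪ app (fst E ↑) O
           ∷ name x ＝ 𝟏 ↪ hcom (B ↑) (r ↑ᵈ) d₀ (M ↑) (T ↑ᵀ)
           ∷ []))
  coe-V-0   : ∀ {A B E r′ M} →
    coe (V d₀ A B E) 𝟎 r′ M ⟼
    Vin r′ M (coe B 𝟎 r′ (app (fst (E ⟨ 𝟎 ∷ id ⟩)) M))
  coe-V-1   : ∀ {A B E r′ N} →
    let C : Tm₀ Ψ
        C = coe B 𝟏 r′ N
        O : Tm₀ Ψ
        O = fst (app (snd (E ⟨ r′ ∷ id ⟩)) C)
        P : Tm₀ Ψ
        P = hcom (B ⟨ r′ ∷ id ⟩) 𝟏 𝟎 C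
              ( r′ ＝ 𝟎 ↪ snd O ↑ ＠ d₀
              ∷ r′ ＝ 𝟏 ↪ C ↑
              ∷ [])
    in coe (V d₀ A B E) 𝟏 r′ N ⟼ Vin r′ (fst O) P
  coe-V-name : ∀ {A B E y r′ M} →
    coe (V d₀ A B E) (name y) r′ M ⟼ CoeV.result A B E y r′ M
  coe-V-other : ∀ {x A B E r r′ M} →
    coe (V (name (suc x)) A B E) r r′ M ⟼
    Vin (name x) (coe A r r′ M)
      (com B r r′ (Vproj (name x) M (fst (E ⟨ r ∷ id ⟩)))
        ( name x ＝ 𝟎 ↪ app (fst E) (coe (A ↑₁) (r ↑ᵈ) d₀ (M ↑))
        ∷ name x ＝ 𝟏 ↪ coe (B ↑₁) (r ↑ᵈ) d₀ (M ↑)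
        ∷ []))

  hcom-U    : ∀ {j r r′ M T} → hcom (U Kan j) r r′ M T ⟼ fcom r r′ M T
  coe-U     : ∀ {κ j r r′ M} → coe (U κ j) r r′ M ⟼ M
  box-cap   : ∀ {r M Ns} → box r r M Ns ⟼ M
  box-side  : ∀ {r r′ M Ns₁ s N Ns₂} → r ≢ r′ → NoneHolds Ns₁ →
              box r r′ M (Ns₁ ++ s ＝ s ↪ N ∷ Ns₂) ⟼ N
  cap-cap   : ∀ {r M T} → cap r r M T ⟼ M
  cap-tube  : ∀ {r r′ M T₁ s B T₂} → r ≢ r′ → NoneHolds T₁ →
              cap r r′ M (T₁ ++ s ＝ s ↪ B ∷ T₂) ⟼ coe B r′ r M
  cap-box   : ∀ {r r′ M Ns T} → r ≢ r′ → NoneHolds Ns →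
              List.map proj₁ Ns ≡ List.map proj₁ T →
              cap r r′ (box r r′ M Ns) T ⟼ M
  hcom-fcom : ∀ {s s′ A Bs r r′ M T} → s ≢ s′ → NoneHolds Bs →
    hcom (fcom s s′ A Bs) r r′ M T ⟼ HcomFcom.result s s′ A Bs r r′ M T
  coe-fcom  : ∀ {s s′ A Bs r r′ M} → s ≢ s′ → NoneHolds Bs →
    coe (fcom s s′ A Bs) r r′ M ⟼ CoeFcom.result s s′ A Bs r r′ M

_⟼*_ : ∀ {Ψ} → Tm₀ Ψ → Tm₀ Ψ → Set
_⟼*_ = Star _⟼_

_⇓_ : ∀ {Ψ} → Tm₀ Ψ → Tm₀ Ψ → Set
M ⇓ W = M ⟼* W × Val W

Rel : ℕ → Set₁
Rel Ψ = Tm₀ Ψ → Tm₀ Ψ → Set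

infix 4 _≣_
_≣_ : ∀ {Ψ} → Rel Ψ → Rel Ψ → Set
R ≣ S = ∀ M N → R M N ⇔ S M N

_^⇓ : ∀ {Ψ} → Rel Ψ → Rel Ψ
(R ^⇓) M N = ∃[ W ] ∃[ W′ ] (M ⇓ W × N ⇓ W′ × R W W′)

ΨRel : ℕ → Set₁
ΨRel Ψ = ∀ {Ψ′} → DSub Ψ′ Ψ → Rel Ψ′

infixl 8 _·_
_·_ : ∀ {Ψ Ψ′} → ΨRel Ψ → DSub Ψ′ Ψ → ΨRel Ψ′
(α · ψ) ψ′ = α (ψ ⨟ ψ′)

CRel : Set₁
CRel = ∀ Ψ → Rel Ψ

at : CRel → ∀ Ψ → ΨRel Ψ
at R _ {Ψ′} _ = R Ψ′

Tm : ∀ {Ψ} → ΨRel Ψ → Rel Ψ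
Tm {Ψ} α M N =
  ∀ {Ψ₁ Ψ₂} (ψ₁ : DSub Ψ₁ Ψ) (ψ₂ : DSub Ψ₂ Ψ₁) →
  ∃[ M₁ ] ∃[ N₁ ]
    ( M ⟨ ψ₁ ⟩ ⇓ M₁
    × N ⟨ ψ₁ ⟩ ⇓ N₁
    × (α (ψ₁ ⨟ ψ₂) ^⇓) (M₁ ⟨ ψ₂ ⟩) (M ⟨ ψ₁ ⟩ ⟨ ψ₂ ⟩)
    × (α (ψ₁ ⨟ ψ₂) ^⇓) (M ⟨ ψ₁ ⟩ ⟨ ψ₂ ⟩) (M₁ ⟨ ψ₂ ⟩)
    × (α (ψ₁ ⨟ ψ₂) ^⇓) (N₁ ⟨ ψ₂ ⟩) (N ⟨ ψ₁ ⟩ ⟨ ψ₂ ⟩)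
    × (α (ψ₁ ⨟ ψ₂) ^⇓) (N ⟨ ψ₁ ⟩ ⟨ ψ₂ ⟩) (N₁ ⟨ ψ₂ ⟩)
    × (α (ψ₁ ⨟ ψ₂) ^⇓) (M₁ ⟨ ψ₂ ⟩) (N₁ ⟨ ψ₂ ⟩))

Tm-id : ∀ {Ψ} (α : ΨRel Ψ) M N → Tm α M N → Tm (α · id) M N
Tm-id α M N m ψ₁ ψ₂ =
  subst (λ ψ → ∃[ M₁ ] ∃[ N₁ ]
    ( M ⟨ ψ₁ ⟩ ⇓ M₁
    × N ⟨ ψ₁ ⟩ ⇓ N₁
    × (α ψ ^⇓) (M₁ ⟨ ψ₂ ⟩) (M ⟨ ψ₁ ⟩ ⟨ ψ₂ ⟩)
    × (α ψ ^⇓) (M ⟨ ψ₁ ⟩ ⟨ ψ₂ ⟩) (M₁ ⟨ ψ₂ ⟩)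
    × (α ψ ^⇓) (N₁ ⟨ ψ₂ ⟩) (N ⟨ ψ₁ ⟩ ⟨ ψ₂ ⟩)
    × (α ψ ^⇓) (N ⟨ ψ₁ ⟩ ⟨ ψ₂ ⟩) (N₁ ⟨ ψ₂ ⟩)
    × (α ψ ^⇓) (M₁ ⟨ ψ₂ ⟩) (N₁ ⟨ ψ₂ ⟩)))
    (sym (id-⨟ (ψ₁ ⨟ ψ₂))) (m ψ₁ ψ₂)

Coh : ∀ {Ψ} → ΨRel Ψ → Set
Coh {Ψ} α = ∀ {Ψ′} (ψ : DSub Ψ′ Ψ) {M₀ N₀} → α ψ M₀ N₀ → Tm (α · ψ) M₀ N₀

-- Lists ξ_i ↪ N_i, indexed by i : Fin n, in which several families N_i
-- can share the same equations ξ_i.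
entries : ∀ {n} {X Y : Set} → Vec X n → Vec Y n → List (X × Y)
entries ξs Ns = Vec.toList (Vec.zip ξs Ns)

-- The side condition (†).
record Valid {Ψ n} (r r′ : Dim Ψ) (ξs : Vec (Eqn Ψ) n) : Set where
  field
    r≢r′      : r ≢ r′
    noneHolds : ∀ i → ¬ Holds (lookup ξs i)
    covers    : ∃[ i ] ∃[ j ] ∃[ s ]
                  (lookup ξs i ≡ (s ＝ 𝟎) × lookup ξs j ≡ (s ＝ 𝟏))

-- A substitution ψ : Ψ′ → (Ψ, y) acts on the r_i, in which y does not
-- occur, through tail ψ.
data FKan (R : CRel) (Ψ : ℕ) : Rel Ψ where
  fcom : ∀ {n r r′ M M′} {ξs : Vec (Eqn Ψ) n} {Ns Ns′ : Vec (Tm₀ (suc Ψ)) n} →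
    Valid r r′ ξs →
    Tm (at R Ψ) M M′ →
    (∀ i j {Ψ′} (ψ : DSub Ψ′ (suc Ψ)) →
       Holds (lookup ξs i ⟨ tail ψ ⟩ᵉ) → Holds (lookup ξs j ⟨ tail ψ ⟩ᵉ) →
       Tm (at R Ψ′) (lookup Ns i ⟨ ψ ⟩) (lookup Ns′ j ⟨ ψ ⟩)) →
    (∀ i {Ψ′} (ψ : DSub Ψ′ Ψ) →
       Holds (lookup ξs i ⟨ ψ ⟩ᵉ) →
       Tm (at R Ψ′) (lookup Ns i ⟨ r ∷ id ⟩ ⟨ ψ ⟩) (M ⟨ ψ ⟩)) →
    FKan R Ψ (fcom r r′ M (entries ξs Ns)) (fcom r r′ M′ (entries ξs Ns′))

data VoidRel {Ψ} : Rel Ψ where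

data ℕRel : CRel where
  ze : ∀ {Ψ} → ℕRel Ψ ze ze
  su : ∀ {Ψ M M′} → Tm (at ℕRel Ψ) M M′ → ℕRel Ψ (su M) (su M′)

data BoolRel {Ψ} : Rel Ψ where
  true  : BoolRel true true
  false : BoolRel false false

data 𝔹Rel : CRel where
  true  : ∀ {Ψ} → 𝔹Rel Ψ true true
  false : ∀ {Ψ} → 𝔹Rel Ψ false false
  fkan  : ∀ {Ψ M N} → FKan 𝔹Rel Ψ M N → 𝔹Rel Ψ M N

data ℂRel : CRel where
  base : ∀ {Ψ} → ℂRel Ψ base base
  loop : ∀ {Ψ} (x : Fin Ψ) → ℂRel Ψ (loop (name x)) (loop (name x))
  fkan : ∀ {Ψ M N} → FKan ℂRel Ψ M N → ℂRel Ψ M N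

-- Families such as β^{ψ,M,M′} are only defined when their side conditions
-- hold, so they take proofs of these as arguments.
Family : ∀ {Ψ} → ΨRel Ψ → Set₁
Family {Ψ} α =
  ∀ {Ψ′} (ψ : DSub Ψ′ Ψ) M M′ → Tm (α · ψ) M M′ → ΨRel Ψ′

data FunRel {Ψ} (α : ΨRel Ψ) (β : Family α) : Rel Ψ where
  lam : ∀ {N N′} →
    (∀ {Ψ′} (ψ : DSub Ψ′ Ψ) M M′ (m : Tm (α · ψ) M M′) →
       Tm (β ψ M M′ m) (N ⟨ ψ ⟩ [ M ∷ [] ]) (N′ ⟨ ψ ⟩ [ M′ ∷ [] ])) →
    FunRel α β (lam N) (lam N′)

data PairRel {Ψ} (α : ΨRel Ψ) (β : Family α) : Rel Ψ where
  pair : ∀ {M M′ N N′} →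
    (m : Tm α M M′) →
    Tm (β id M M′ (Tm-id α M M′ m)) N N′ →
    PairRel α β (pair M N) (pair M′ N′)

data PathRel {Ψ} (α : ΨRel (suc Ψ)) (P : Endpoint → Tm₀ Ψ) : Rel Ψ where
  dlam : ∀ {M M′} →
    Tm α M M′ →
    (∀ ε → Tm (α · (end ε ∷ id)) (M ⟨ end ε ∷ id ⟩) (P ε)) →
    PathRel α P (dlam M) (dlam M′)

data EqRel {Ψ} (α : ΨRel Ψ) (M N : Tm₀ Ψ) : Rel Ψ where
  ⋆ : Tm α M N → EqRel α M N ⋆ ⋆

data VRel {Ψ} (x : Fin Ψ) (E : Tm₀ Ψ) (β : ΨRel Ψ)
          (α : ∀ {Ψ′} (ψ : DSub Ψ′ Ψ) → lookup ψ x ≡ 𝟎 → ΨRel Ψ′) : Rel Ψ where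
  Vin : ∀ {M M′ N N′} →
    Tm β N N′ →
    (∀ {Ψ′} (ψ : DSub Ψ′ Ψ) (x≡0 : lookup ψ x ≡ 𝟎) →
       Tm (α ψ x≡0) (M ⟨ ψ ⟩) (M′ ⟨ ψ ⟩)
     × Tm (β · ψ) (app (fst (E ⟨ ψ ⟩)) (M ⟨ ψ ⟩)) (N ⟨ ψ ⟩)) →
    VRel x E β α (Vin (name x) M N) (Vin (name x) M′ N′)

data BoxRel {Ψ n} (r r′ : Dim Ψ) (ξs : Vec (Eqn Ψ) n) (Bs : Vec (Tm₀ (suc Ψ)) n)
            (α : ΨRel Ψ)
            (β : ∀ i j {Ψ′} (ψ : DSub Ψ′ (suc Ψ)) →
                 Holds (lookup ξs i ⟨ tail ψ ⟩ᵉ) → Holds (lookup ξs j ⟨ tail ψ ⟩ᵉ) →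
                 ΨRel Ψ′) : Rel Ψ where
  box : ∀ {M M′} {Ns Ns′ : Vec (Tm₀ Ψ) n} →
    Tm α M M′ →
    (∀ i j {Ψ′} (ψ : DSub Ψ′ Ψ)
       (p : Holds (lookup ξs i ⟨ ψ ⟩ᵉ)) (q : Holds (lookup ξs j ⟨ ψ ⟩ᵉ)) →
       Tm (β i j (lift ψ) (Holds-lift ψ (lookup ξs i) p) (Holds-lift ψ (lookup ξs j) q)
             · (r′ ⟨ ψ ⟩ᵈ ∷ id))
          (lookup Ns i ⟨ ψ ⟩) (lookup Ns′ j ⟨ ψ ⟩)) →
    (∀ i {Ψ′} (ψ : DSub Ψ′ Ψ) →
       Holds (lookup ξs i ⟨ ψ ⟩ᵉ) →
       Tm (α · ψ) (M ⟨ ψ ⟩)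
          (coe (lookup Bs i ⟨ lift ψ ⟩) (r′ ⟨ ψ ⟩ᵈ) (r ⟨ ψ ⟩ᵈ) (lookup Ns i ⟨ ψ ⟩))) →
    BoxRel r r′ ξs Bs α β
      (box r r′ M (entries ξs Ns)) (box r r′ M′ (entries ξs Ns′))

-- A relation τ(Ψ,A,B,φ) quantifying over all relations φ would live in a
-- larger universe than φ, which rules out the limit τ_ω.  Such a τ is
-- therefore given by the derivations Ty Ψ A B of "τ(Ψ,A,B,φ) for some φ"
-- and, for each derivation c, the relation El c it determines; that is,
-- τ(Ψ,A,B,φ) holds iff El c ≣ φ for some c : Ty Ψ A B.
record TypeSystem : Set₁ where
  field
    Ty : (Ψ : ℕ) → Tm₀ Ψ → Tm₀ Ψ → Set
    El : ∀ {Ψ A B} → Ty Ψ A B → Rel Ψ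

-- For κ = Kan this is μ^Kan(ν); for κ = pre it is μ^pre(ν, μ^Kan(ν)).
module Fixpoint (ν : TypeSystem) where

  data Ty (κ : Kind) : (Ψ : ℕ) → Tm₀ Ψ → Tm₀ Ψ → Set
  data Ty⇓ (κ : Kind) (Ψ : ℕ) (A B : Tm₀ Ψ) : Set
  data PTy (κ : Kind) (Ψ : ℕ) (A B : Tm₀ Ψ) : Set
  data Stable (κ : Kind) {Ψ Ψ₁ Ψ₂ : ℕ} (A B : Tm₀ Ψ)
              (ψ₁ : DSub Ψ₁ Ψ) (ψ₂ : DSub Ψ₂ Ψ₁) : Set

  El  : ∀ {κ Ψ A B} → Ty κ Ψ A B → Rel Ψ
  El⇓ : ∀ {κ Ψ A B} → Ty⇓ κ Ψ A B → Rel Ψ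
  rel : ∀ {κ Ψ A B} → PTy κ Ψ A B → ΨRel Ψ

  data Ty⇓ κ Ψ A B where
    eval : ∀ {A₀ B₀} → A ⇓ A₀ → B ⇓ B₀ → Ty κ Ψ A₀ B₀ → Ty⇓ κ Ψ A B

  -- The five derivations must determine the same relation φ.
  data Stable κ {Ψ₂ = Ψ₂} A B ψ₁ ψ₂ where
    stable : ∀ {A₁ B₁} →
      A ⟨ ψ₁ ⟩ ⇓ A₁ →
      B ⟨ ψ₁ ⟩ ⇓ B₁ →
      (c₁ : Ty⇓ κ Ψ₂ (A₁ ⟨ ψ₂ ⟩) (A ⟨ ψ₁ ⟩ ⟨ ψ₂ ⟩))
      (c₂ : Ty⇓ κ Ψ₂ (A ⟨ ψ₁ ⟩ ⟨ ψ₂ ⟩) (A₁ ⟨ ψ₂ ⟩))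
      (c₃ : Ty⇓ κ Ψ₂ (B₁ ⟨ ψ₂ ⟩) (B ⟨ ψ₁ ⟩ ⟨ ψ₂ ⟩))
      (c₄ : Ty⇓ κ Ψ₂ (B ⟨ ψ₁ ⟩ ⟨ ψ₂ ⟩) (B₁ ⟨ ψ₂ ⟩))
      (c₅ : Ty⇓ κ Ψ₂ (A₁ ⟨ ψ₂ ⟩) (B₁ ⟨ ψ₂ ⟩)) →
      El⇓ c₁ ≣ El⇓ c₂ → El⇓ c₁ ≣ El⇓ c₃ → El⇓ c₁ ≣ El⇓ c₄ → El⇓ c₁ ≣ El⇓ c₅ →
      Stable κ A B ψ₁ ψ₂

  -- PTy(τ)(Ψ,A,B,α) for α = rel p, where p : PTy κ Ψ A B.
  data PTy κ Ψ A B where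
    pty : (∀ {Ψ′} (ψ : DSub Ψ′ Ψ) → Ty⇓ κ Ψ′ (A ⟨ ψ ⟩) (B ⟨ ψ ⟩)) →
          (∀ {Ψ₁ Ψ₂} (ψ₁ : DSub Ψ₁ Ψ) (ψ₂ : DSub Ψ₂ Ψ₁) → Stable κ A B ψ₁ ψ₂) →
          PTy κ Ψ A B

  data Ty κ where

    fun : ∀ {Ψ A A′ B B′} →
      (α : PTy κ Ψ A A′) → Coh (rel α) →
      (β : ∀ {Ψ′} (ψ : DSub Ψ′ Ψ) M M′ → Tm (rel α · ψ) M M′ →
           PTy κ Ψ′ (B ⟨ ψ ⟩ [ M ∷ [] ]) (B′ ⟨ ψ ⟩ [ M′ ∷ [] ])) →
      (∀ {Ψ′} (ψ : DSub Ψ′ Ψ) M M′ (m : Tm (rel α · ψ) M M′) → Coh (rel (β ψ M M′ m))) →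
      Ty κ Ψ (pi A B) (pi A′ B′)

    pair : ∀ {Ψ A A′ B B′} →
      (α : PTy κ Ψ A A′) → Coh (rel α) →
      (β : ∀ {Ψ′} (ψ : DSub Ψ′ Ψ) M M′ → Tm (rel α · ψ) M M′ →
           PTy κ Ψ′ (B ⟨ ψ ⟩ [ M ∷ [] ]) (B′ ⟨ ψ ⟩ [ M′ ∷ [] ])) →
      (∀ {Ψ′} (ψ : DSub Ψ′ Ψ) M M′ (m : Tm (rel α · ψ) M M′) → Coh (rel (β ψ M M′ m))) →
      Ty κ Ψ (sg A B) (sg A′ B′)

    path : ∀ {Ψ A A′} (P P′ : Endpoint → Tm₀ Ψ) →
      (α : PTy κ (suc Ψ) A A′) → Coh (rel α) →
      (∀ ε → Tm (rel α · (end ε ∷ id)) (P ε) (P′ ε)) →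
      Ty κ Ψ (path A (P 0ᵉ) (P 1ᵉ)) (path A′ (P′ 0ᵉ) (P′ 1ᵉ))

    eq : ∀ {Ψ A A′ M M′ N N′} → κ ≡ pre →
      (α : PTy κ Ψ A A′) → Coh (rel α) →
      Tm (rel α) M M′ → Tm (rel α) N N′ →
      Ty κ Ψ (eq A M N) (eq A′ M′ N′)

    V : ∀ {Ψ A A′ B B′ E E′} (x : Fin Ψ) →
      (β : PTy κ Ψ B B′) → Coh (rel β) →
      (α : ∀ {Ψ′} (ψ : DSub Ψ′ Ψ) → lookup ψ x ≡ 𝟎 → PTy κ Ψ′ (A ⟨ ψ ⟩) (A′ ⟨ ψ ⟩)) →
      (∀ {Ψ′} (ψ : DSub Ψ′ Ψ) (x≡0 : lookup ψ x ≡ 𝟎) → Coh (rel (α ψ x≡0))) →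
      (η : ∀ {Ψ′} (ψ : DSub Ψ′ Ψ) → lookup ψ x ≡ 𝟎 →
           PTy κ Ψ′ (Equiv (A ⟨ ψ ⟩) (B ⟨ ψ ⟩)) (Equiv (A ⟨ ψ ⟩) (B ⟨ ψ ⟩))) →
      (∀ {Ψ′} (ψ : DSub Ψ′ Ψ) (x≡0 : lookup ψ x ≡ 𝟎) →
         Tm (rel (η ψ x≡0)) (E ⟨ ψ ⟩) (E′ ⟨ ψ ⟩)) →
      Ty κ Ψ (V (name x) A B E) (V (name x) A′ B′ E′)

    fcom : ∀ {Ψ n r r′ A A′} {ξs : Vec (Eqn Ψ) n} {Bs Bs′ : Vec (Tm₀ (suc Ψ)) n} →
      Valid r r′ ξs →
      (α : PTy Kan Ψ A A′) → Coh (rel α) →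
      (β : ∀ i j {Ψ′} (ψ : DSub Ψ′ (suc Ψ)) →
           Holds (lookup ξs i ⟨ tail ψ ⟩ᵉ) → Holds (lookup ξs j ⟨ tail ψ ⟩ᵉ) →
           PTy Kan Ψ′ (lookup Bs i ⟨ ψ ⟩) (lookup Bs′ j ⟨ ψ ⟩)) →
      (∀ i j {Ψ′} (ψ : DSub Ψ′ (suc Ψ))
         (p : Holds (lookup ξs i ⟨ tail ψ ⟩ᵉ)) (q : Holds (lookup ξs j ⟨ tail ψ ⟩ᵉ)) →
         Coh (rel (β i j ψ p q))) →
      (∀ i {Ψ′} (ψ : DSub Ψ′ Ψ) →
         Holds (lookup ξs i ⟨ ψ ⟩ᵉ) →
         PTy Kan Ψ′ (lookup Bs i ⟨ r ∷ id ⟩ ⟨ ψ ⟩) (A ⟨ ψ ⟩)) →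
      Ty κ Ψ (fcom r r′ A (entries ξs Bs)) (fcom r r′ A′ (entries ξs Bs′))

    void  : ∀ {Ψ} → Ty κ Ψ void void
    nat   : ∀ {Ψ} → Ty κ Ψ nat nat
    bool  : ∀ {Ψ} → Ty κ Ψ bool bool
    wbool : ∀ {Ψ} → Ty κ Ψ wbool wbool
    S¹    : ∀ {Ψ} → Ty κ Ψ S¹ S¹

    Upre  : ∀ {Ψ j} → κ ≡ pre → TypeSystem.Ty ν Ψ (U pre j) (U pre j) →
            Ty κ Ψ (U pre j) (U pre j)
    UKan  : ∀ {Ψ j} → TypeSystem.Ty ν Ψ (U Kan j) (U Kan j) →
            Ty κ Ψ (U Kan j) (U Kan j)

  El (fun α _ β _)   = FunRel (rel α) (λ ψ M M′ m → rel (β ψ M M′ m))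
  El (pair α _ β _)  = PairRel (rel α) (λ ψ M M′ m → rel (β ψ M M′ m))
  El (path P _ α _ _) = PathRel (rel α) P
  El (eq {M = M} {N = N} _ α _ _ _) = EqRel (rel α) M N
  El (V {E = E} x β _ α _ _ _) = VRel x E (rel β) (λ ψ x≡0 → rel (α ψ x≡0))
  El (fcom {r = r} {r′ = r′} {ξs = ξs} {Bs = Bs} _ α _ β _ _) =
    BoxRel r r′ ξs Bs (rel α) (λ i j ψ p q → rel (β i j ψ p q))
  El void       = VoidRel
  El nat        = ℕRel _
  El bool       = BoolRel
  El wbool      = 𝔹Rel _
  El S¹         = ℂRel _
  El (Upre _ u) = TypeSystem.El ν u
  El (UKan u)   = TypeSystem.El ν u

  El⇓ (eval _ _ c) = El c

  rel (pty c _) ψ = El⇓ (c ψ)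

μ : TypeSystem → Kind → TypeSystem
μ ν κ = record { Ty = Fixpoint.Ty ν κ ; El = Fixpoint.El ν }

-- The type system whose types are the U^κ_j with j satisfying S, where
-- τ j κ gives the types classified by U^κ_j.
data Univ (S : ℕ → Set) : (Ψ : ℕ) → Tm₀ Ψ → Tm₀ Ψ → Set where
  univ : ∀ {Ψ j} → S j → (κ : Kind) → Univ S Ψ (U κ j) (U κ j)

universes : (S : ℕ → Set) → (∀ {j} → S j → Kind → TypeSystem) → TypeSystem
universes S τ = record { Ty = Univ S ; El = λ { (univ s κ) → TypeSystem.Ty (τ s κ) _ } }

ν : ℕ → TypeSystem
ν = <-rec _ λ n ν< → universes (_< n) (λ j<n → μ (ν< j<n))

τ : Kind → ℕ → TypeSystem
τ κ n = μ (ν n) κ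

ν-ω : TypeSystem
ν-ω = universes (λ _ → ⊤) (λ {j} _ κ → τ κ j)

-- The judgments relative to μ ν κ; they are used with μ ν-ω pre, which is
-- τ^pre_ω.
module Judgments (ν : TypeSystem) (κ : Kind) where
  open Fixpoint ν using (PTy; rel)

  infix 3 _⊢_≐_type _⊢_≐_∈_ _⊢_∈_

  record _⊢_≐_type (Ψ : ℕ) (A B : Tm₀ Ψ) : Set where
    field
      pretype  : PTy κ Ψ A B
      coherent : Coh (rel pretype)

    ⟦A⟧ : ΨRel Ψ
    ⟦A⟧ = rel pretype

  -- The first component is the presupposition that A is a type.
  _⊢_≐_∈_ : (Ψ : ℕ) → Tm₀ Ψ → Tm₀ Ψ → Tm₀ Ψ → Set
  Ψ ⊢ M ≐ N ∈ A = ∃[ T ] Tm (_⊢_≐_type.⟦A⟧ {Ψ} {A} {A} T) M N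

  _⊢_∈_ : (Ψ : ℕ) → Tm₀ Ψ → Tm₀ Ψ → Set
  Ψ ⊢ M ∈ A = Ψ ⊢ M ≐ M ∈ A

open Judgments ν-ω pre public

{-# OPTIONS --safe #-}
module Submission where

open import Data.Fin using (Fin; zero; suc)
open import Data.List using ([]; _∷_)
open import Data.Nat using (ℕ; suc)
open import Data.Product using (_,_)
open import Data.Sum using (_⊎_; inj₁; inj₂)
open import Data.Vec as Vec using (Vec; _∷_)
open import Data.Vec.Properties
  using (allFin-map; lookup-allFin; lookup-map; map-id; map-∘; tabulate-allFin)
open import Defs
open import Relation.Binary.Construct.Closure.ReflexiveTransitive using (Star)
open import Relation.Binary.PropositionalEquality
  using (_≡_; refl; sym; trans; cong; cong₂; subst)

open Renaming using (trav; travᵀ; travˢ)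

-- Membership in `bool` is needed only at the identity substitutions. There it says that
-- `M ⟨ id ⟩ ⟨ id ⟩` evaluates to some `W` related to some `W′` by the relation assigned to `bool`.
-- By `bool-rel`, every derivation that `bool` is a type assigns it `BoolRel`, whose only pairs are
-- `true` with `true` and `false` with `false`; hence `W` is one of the two. It remains to replace
-- `M ⟨ id ⟩ ⟨ id ⟩` by `M`. Substitution is a recursive traversal, so its identity law takes an
-- induction over all term formers, `trav-id`.

liftᵛ-allFin : ∀ {Γ} {σ : Vec (Fin Γ) Γ} → σ ≡ Vec.allFin Γ →
               zero ∷ Vec.map suc σ ≡ Vec.allFin (suc Γ)
liftᵛ-allFin {Γ} refl = sym (allFin-map Γ)

-- Passing under a dimension binder leaves variable indices alone: `wkDim` of `renaming-kit` is the
-- identity function, so `under σ` unfolds to this map.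
under-allFin : ∀ {Γ} {σ : Vec (Fin Γ) Γ} → σ ≡ Vec.allFin Γ →
               Vec.map (λ a → a) σ ≡ Vec.allFin Γ
under-allFin refl = map-id _

lift-id : ∀ {Ψ} {ψ : DSub Ψ Ψ} → ψ ≡ id → lift ψ ≡ id
-- The tails agree because shifting after `name` is `name` after `suc`, and the tail of `allFin` is
-- `allFin` mapped by `suc`.
lift-id refl = cong (d₀ ∷_)
  (trans (sym (map-∘ _↑ᵈ name _))
  (trans (map-∘ name suc _)
         (cong (Vec.map name) (sym (tabulate-allFin suc)))))

⟨⟩ᵈ-id : ∀ {Ψ} {ψ : DSub Ψ Ψ} → ψ ≡ id → (r : Dim Ψ) → r ⟨ ψ ⟩ᵈ ≡ r
⟨⟩ᵈ-id refl (end ε)  = refl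
⟨⟩ᵈ-id refl (name x) = trans (lookup-map x name (Vec.allFin _)) (cong name (lookup-allFin x))

⟨⟩ᵉ-id : ∀ {Ψ} {ψ : DSub Ψ Ψ} → ψ ≡ id → (ξ : Eqn Ψ) → ξ ⟨ ψ ⟩ᵉ ≡ ξ
⟨⟩ᵉ-id p (r ＝ r′) = cong₂ _,_ (⟨⟩ᵈ-id p r) (⟨⟩ᵈ-id p r′)

-- The identities are hypotheses so that the induction applies under binders,
-- where lift id and the extended σ are identities only propositionally.
trav-id : ∀ {Ψ Γ} {ψ : DSub Ψ Ψ} {σ : Vec (Fin Γ) Γ} → ψ ≡ id → σ ≡ Vec.allFin Γ →
          (M : Term Ψ Γ) → trav ψ σ M ≡ M
travᵀ-id : ∀ {Ψ Γ} {ψ : DSub Ψ Ψ} {σ : Vec (Fin Γ) Γ} → ψ ≡ id → σ ≡ Vec.allFin Γ →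
           (T : Tubes Ψ Γ) → travᵀ ψ σ T ≡ T
travˢ-id : ∀ {Ψ Γ} {ψ : DSub Ψ Ψ} {σ : Vec (Fin Γ) Γ} → ψ ≡ id → σ ≡ Vec.allFin Γ →
           (Ns : Sides Ψ Γ) → travˢ ψ σ Ns ≡ Ns

trav-id refl refl (var a) = cong var (lookup-allFin a)
trav-id p q (pi A B)
  rewrite trav-id p q A | trav-id p (liftᵛ-allFin q) B = refl
trav-id p q (sg A B)
  rewrite trav-id p q A | trav-id p (liftᵛ-allFin q) B = refl
trav-id p q (path A M N)
  rewrite trav-id (lift-id p) (under-allFin q) A | trav-id p q M | trav-id p q N = refl
trav-id p q (eq A M N)
  rewrite trav-id p q A | trav-id p q M | trav-id p q N = refl
trav-id p q void = refl
trav-id p q nat = refl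
trav-id p q bool = refl
trav-id p q wbool = refl
trav-id p q S¹ = refl
trav-id p q (U κ j) = refl
trav-id p q (V r A B E)
  rewrite ⟨⟩ᵈ-id p r | trav-id p q A | trav-id p q B | trav-id p q E = refl
trav-id p q (Vin r M N)
  rewrite ⟨⟩ᵈ-id p r | trav-id p q M | trav-id p q N = refl
trav-id p q (Vproj r M F)
  rewrite ⟨⟩ᵈ-id p r | trav-id p q M | trav-id p q F = refl
trav-id p q (lam M) rewrite trav-id p (liftᵛ-allFin q) M = refl
trav-id p q (app M N)
  rewrite trav-id p q M | trav-id p q N = refl
trav-id p q (pair M N)
  rewrite trav-id p q M | trav-id p q N = refl
trav-id p q (fst M) rewrite trav-id p q M = refl
trav-id p q (snd M) rewrite trav-id p q M = refl
trav-id p q (dlam M) rewrite trav-id (lift-id p) (under-allFin q) M = refl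
trav-id p q (M ＠ r)
  rewrite trav-id p q M | ⟨⟩ᵈ-id p r = refl
trav-id p q ⋆ = refl
trav-id p q ze = refl
trav-id p q (su M) rewrite trav-id p q M = refl
trav-id p q (natrec M Z S)
  rewrite trav-id p q M | trav-id p q Z
        | trav-id p (liftᵛ-allFin (liftᵛ-allFin q)) S = refl
trav-id p q true = refl
trav-id p q false = refl
trav-id p q (if A M T F)
  rewrite trav-id p (liftᵛ-allFin q) A | trav-id p q M | trav-id p q T
        | trav-id p q F = refl
trav-id p q base = refl
trav-id p q (loop r) rewrite ⟨⟩ᵈ-id p r = refl
trav-id p q (S¹elim A M P L)
  rewrite trav-id p (liftᵛ-allFin q) A | trav-id p q M | trav-id p q P
        | trav-id (lift-id p) (under-allFin q) L = refl
trav-id p q (coe A r r′ M)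
  rewrite trav-id (lift-id p) (under-allFin q) A | ⟨⟩ᵈ-id p r | ⟨⟩ᵈ-id p r′
        | trav-id p q M = refl
trav-id p q (hcom A r r′ M T)
  rewrite trav-id p q A | ⟨⟩ᵈ-id p r | ⟨⟩ᵈ-id p r′ | trav-id p q M | travᵀ-id p q T = refl
trav-id p q (com A r r′ M T)
  rewrite trav-id (lift-id p) (under-allFin q) A | ⟨⟩ᵈ-id p r | ⟨⟩ᵈ-id p r′
        | trav-id p q M | travᵀ-id p q T = refl
trav-id p q (fcom r r′ M T)
  rewrite ⟨⟩ᵈ-id p r | ⟨⟩ᵈ-id p r′ | trav-id p q M | travᵀ-id p q T = refl
trav-id p q (ghcom A r r′ M T)
  rewrite trav-id p q A | ⟨⟩ᵈ-id p r | ⟨⟩ᵈ-id p r′ | trav-id p q M | travᵀ-id p q T = refl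
trav-id p q (gcom A r r′ M T)
  rewrite trav-id (lift-id p) (under-allFin q) A | ⟨⟩ᵈ-id p r | ⟨⟩ᵈ-id p r′
        | trav-id p q M | travᵀ-id p q T = refl
trav-id p q (box r r′ M Ns)
  rewrite ⟨⟩ᵈ-id p r | ⟨⟩ᵈ-id p r′ | trav-id p q M | travˢ-id p q Ns = refl
trav-id p q (cap r r′ M T)
  rewrite ⟨⟩ᵈ-id p r | ⟨⟩ᵈ-id p r′ | trav-id p q M | travᵀ-id p q T = refl

travᵀ-id p q [] = refl
travᵀ-id p q (ξ ↪ N ∷ T)
  rewrite ⟨⟩ᵉ-id p ξ | trav-id (lift-id p) (under-allFin q) N | travᵀ-id p q T = refl

travˢ-id p q [] = refl
travˢ-id p q (ξ ↪ N ∷ Ns)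
  rewrite ⟨⟩ᵉ-id p ξ | trav-id p q N | travˢ-id p q Ns = refl

⟨id⟩ : ∀ {Ψ} (M : Tm₀ Ψ) → M ⟨ id ⟩ ≡ M
⟨id⟩ = trav-id refl refl

open Fixpoint ν-ω using (PTy; pty; eval; rel; bool)

-- The judgment supplies an arbitrary derivation, and the relation is read off from it; inverting
-- the derivation identifies this relation.
bool-rel : ∀ {κ Ψ Ψ′} (p : PTy κ Ψ bool bool) (ψ : DSub Ψ′ Ψ) {M N : Tm₀ Ψ′} →
           rel p ψ M N → BoolRel M N
bool-rel (pty c _) ψ m with c ψ
-- `bool` takes no step, so both evaluations are empty and only the rule `bool` applies; `El` then
-- reduces to `BoolRel`.
... | eval (Star.ε , _) (Star.ε , _) bool = m

theorem1 : (Ψ : ℕ) (M : Tm₀ Ψ) → Ψ ⊢ M ∈ bool → (M ⇓ true) ⊎ (M ⇓ false)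
theorem1 Ψ M (T , m)
  -- Of the five related pairs, the second is kept: its left member is `M ⟨ id ⟩ ⟨ id ⟩`.
  with M₁ , N₁ , _ , _ , _ , (W , W′ , M⇓W , _ , w) , _ ← m id id
  with bool-rel (_⊢_≐_type.pretype T) _ w
-- The identity law is used twice, once for each of the two substitutions.
... | true  = inj₁ (subst (_⇓ true) (trans (⟨id⟩ _) (⟨id⟩ M)) M⇓W)
... | false = inj₂ (subst (_⇓ false) (trans (⟨id⟩ _) (⟨id⟩ M)) M⇓W)
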